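{- Let $m,n\ge 1$ be integers and let $M$ be any matching of size $k$ in the complete bipartite graph $K_{m,n}$. Then the number $\tau_M(K_{m,n})$ of spanning trees of $K_{m,n}$ that contain every edge of $M$ is $$\tau_M(K_{m,n})=(m+n)^{k-1}(m+n-k)\,m^{n-k-1}n^{m-k-1}.$$
   Context: $K_{m,n}$ denotes the complete bipartite graph with parts of sizes $m$ and $n$. For a subgraph (or edge set) $H$ of a graph $G$, $\tau_H(G)$ denotes the number of spanning trees of $G$ containing all edges of $H$. -}

module Defs where

open import Data.Nat as ℕ using (ℕ; zero; suc; _+_; _≤_)
open import Data.Nat.Properties using (m^n≢0)
open import Data.Integer as ℤ using (ℤ; +_; -[1+_])
open import Data.Rational as ℚ using (ℚ; _/_)
open import Data.Bool using (Bool; true; false)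
open import Data.Fin using (Fin)
open import Data.Vec using (Vec; []; _∷_; lookup)
open import Data.List using (List; []; _∷_; _++_; [_]; length)
open import Data.List.Relation.Unary.Unique.Propositional using (Unique)
open import Data.List.Relation.Unary.Linked using (Linked)
open import Data.List.Membership.Propositional using (_∈_)
open import Data.Sum using (_⊎_; inj₁; inj₂)
open import Data.Product using (Σ; _×_; _,_)
open import Data.Empty using (⊥)
open import Relation.Nullary using (¬_)
open import Relation.Binary.PropositionalEquality using (_≡_)
open import Relation.Binary.Construct.Closure.ReflexiveTransitive using (Star)
open import Function.Bundles using (_⇔_)

-- The complete bipartite graph K_{m,n}
-- Vertices: Fin m ⊎ Fin n (the two parts).  Edges: exactly the pairs
-- (i , j) : Fin m × Fin n, i.e. every vertex of one part is joined to
-- every vertex of the other part.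
-- An edge set (= spanning subgraph) of K_{m,n} is a Boolean m×n matrix;
-- entry (i , j) is true iff edge {inj₁ i , inj₂ j} is present.

Vertex : ℕ → ℕ → Set
Vertex m n = Fin m ⊎ Fin n

EdgeSet : ℕ → ℕ → Set
EdgeSet m n = Vec (Vec Bool n) m

_∋ₑ_,_ : ∀ {m n} → EdgeSet m n → Fin m → Fin n → Set
E ∋ₑ i , j = lookup (lookup E i) j ≡ true

_⊆ₑ_ : ∀ {m n} → EdgeSet m n → EdgeSet m n → Set
_⊆ₑ_ {m} {n} E F = (i : Fin m) (j : Fin n) → E ∋ₑ i , j → F ∋ₑ i , j

Adj : ∀ {m n} → EdgeSet m n → Vertex m n → Vertex m n → Set
Adj E (inj₁ i) (inj₁ i′) = ⊥
Adj E (inj₁ i) (inj₂ j)  = E ∋ₑ i , j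
Adj E (inj₂ j) (inj₁ i)  = E ∋ₑ i , j
Adj E (inj₂ j) (inj₂ j′) = ⊥

Connected : ∀ {m n} → EdgeSet m n → Set
Connected {m} {n} E = (u v : Vertex m n) → Star (Adj E) u v

HasCycle : ∀ {m n} → EdgeSet m n → Set
HasCycle {m} {n} E =
  Σ (Vertex m n) λ v → Σ (List (Vertex m n)) λ vs →
    (2 ≤ length vs) × Unique (v ∷ vs) × Linked (Adj E) (v ∷ vs ++ [ v ])

Acyclic : ∀ {m n} → EdgeSet m n → Set
Acyclic E = ¬ HasCycle E

IsSpanningTree : ∀ {m n} → EdgeSet m n → Set
IsSpanningTree E = Connected E × Acyclic E

IsMatching : ∀ {m n} → EdgeSet m n → Set
IsMatching {m} {n} M =
  ((i : Fin m) (j j′ : Fin n) → M ∋ₑ i , j → M ∋ₑ i , j′ → j ≡ j′) ×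
  ((i i′ : Fin m) (j : Fin n) → M ∋ₑ i , j → M ∋ₑ i′ , j → i ≡ i′)

countTrue : ∀ {n} → Vec Bool n → ℕ
countTrue []           = 0
countTrue (true  ∷ bs) = suc (countTrue bs)
countTrue (false ∷ bs) = countTrue bs

edgeCount : ∀ {m n} → EdgeSet m n → ℕ
edgeCount []         = 0
edgeCount (r ∷ rows) = countTrue r + edgeCount rows

CountIs : ∀ {m n} → (EdgeSet m n → Set) → ℕ → Set
CountIs {m} {n} P N =
  Σ (List (EdgeSet m n)) λ L →
    Unique L × ((T : EdgeSet m n) → (T ∈ L) ⇔ P T) × (length L ≡ N)

-- b ^ e for a natural base b and integer exponent e, as a rational.
-- (For b = 0 and negative e the value is a junk 0; never used below,
-- since all bases in the theorem are ≥ 1.)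
zpow : ℕ → ℤ → ℚ
zpow b (+ e)         = (+ (b ℕ.^ e)) / 1
zpow zero -[1+ e ]   = ℚ.0ℚ
zpow (suc b) -[1+ e ] = _/_ (+ 1) (suc b ℕ.^ suc e) {{m^n≢0 (suc b) (suc e)}}

ℕ→ℚ : ℕ → ℚ
ℕ→ℚ a = (+ a) / 1

{-# OPTIONS --safe #-}
module Submission where

-- Prove more generally a formula for the number τ(F) of spanning trees that contain a forest F.  If the
-- components of F have a_l left and b_l right vertices, put x_l = a_l n + b_l m; then
--   m n τ(F) = ∏ x_l · (1 − ∑ a_l b_l / x_l).
-- This follows by induction on the number c of components from a double count: every tree T ⊇ F has exactly
-- c − 1 edges outside F, and each of them joins two components, so
--   (c − 1) τ(F) = ∑ τ(F + e), summed over the edges e joining two components of F.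
-- That the right-hand side of the formula satisfies this recursion comes down to
-- (∑ a_l² / x_l) (∑ b_l² / x_l) = (1 − ∑ a_l b_l / x_l)², which follows from ∑ a_l = m and ∑ b_l = n.
-- For a matching, k components have x_l = m + n and the remaining ones x_l = n or x_l = m.

open import Defs
open import Data.Bool using (Bool; true; false)
import Data.Bool.Properties as Bool
open import Data.Empty using (⊥; ⊥-elim)
open import Data.Fin as Fin using (Fin)
import Data.Fin.Properties as Fin
open import Data.Integer as ℤ using (+_; -[1+_]) renaming (_-_ to _-ℤ_)
import Data.Integer.Properties as ℤ
open import Data.List using (List; []; _∷_; _++_; [_]; length; map; filter; allFin; cartesianProduct; cartesianProductWith)
open import Data.List.Membership.Propositional using (_∈_; _∉_)
open import Data.List.Membership.Propositional.Properties
import Data.List.Membership.DecPropositional as DecMembership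
open import Data.List.Properties using (length-tabulate; map-tabulate)
open import Data.List.Relation.Unary.All as All using (All; []; _∷_)
import Data.List.Relation.Unary.All.Properties as All
open import Data.List.Relation.Unary.AllPairs using ([]; _∷_)
open import Data.List.Relation.Unary.Any using (here; there)
open import Data.List.Relation.Unary.Linked using (Linked; [-]; _∷_)
open import Data.List.Relation.Unary.Unique.Propositional using (Unique)
import Data.List.Relation.Unary.Unique.Propositional.Properties as Unique
open import Data.List.Relation.Binary.Permutation.Propositional as ↭ using (_↭_; prep; swap; ↭⇒↭ₛ; ↭-sym)
open import Data.List.Relation.Binary.Permutation.Propositional.Properties using (∈-resp-↭; shift; ↭-length)
import Data.List.Relation.Binary.Permutation.Setoid.Properties as ↭ₛ
open import Data.Nat as ℕ using (ℕ; zero; suc; s≤s; z≤n)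
import Data.Nat.Properties as ℕ
open import Data.Product using (Σ; ∃; ∃₂; _×_; _,_; proj₁; proj₂)
import Data.Product.Properties as Product
open import Data.Rational as ℚ using (ℚ; 0ℚ; 1ℚ; _+_; _*_; _-_; -_)
import Data.Rational.Properties as ℚ
open import Data.Rational.Solver using (module +-*-Solver)
import Data.Rational.Unnormalised as ℚᵘ
import Data.Rational.Unnormalised.Properties as ℚᵘ
open import Data.Sum as Sum using (_⊎_; inj₁; inj₂)
import Data.Sum.Properties as Sum
open import Data.Vec using (Vec; []; _∷_; lookup; _[_]≔_; _[_]%=_; replicate)
import Data.Vec.Properties as Vec
open import Function using (_∘_; _$_; id)
open import Function.Bundles using (mk⇔)
open import Relation.Binary.Construct.Closure.ReflexiveTransitive as Star using (Star; ε; _◅_; _◅◅_)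
open import Relation.Binary.Definitions using (DecidableEquality)
open import Relation.Binary.PropositionalEquality hiding ([_])
open import Relation.Nullary using (¬_; Dec; yes; no; ¬?; _×-dec_)
open import Relation.Nullary.Decidable using (decidable-stable)
open import Relation.Unary using (Decidable)

open +-*-Solver using (solve; _:=_; _:+_; _:*_; _:-_; :-_; con)

-- The detour through forests is forced: adding an edge to a matching need not leave a matching,
-- whereas adding an edge between two components of a forest leaves a forest with one component
-- fewer. With `a k * b l` edges from the left vertices of component k to the right vertices of
-- component l, the sum over edges becomes a sum over ordered pairs k ≠ l. Merging k and l changes
-- the value by an explicit expression in the reciprocals of the weights, so the recursion is a
-- double sum over all pairs from which the diagonal is removed.
--
-- Two obstacles shape the combinatorial half. A cycle given as a list of vertices is hard to follow
-- when edges are added or deleted, so acyclicity is traded for the condition that every edge is a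
-- bridge. Counting by indicators also requires "is a spanning tree" to be decidable; this comes
-- from growing a maximal forest inside the given edge set and comparing the two.

private variable
  A B : Set

-- Indicators, finite sums and finite products

𝟙 : {P : Set} → Dec P → ℚ
𝟙 (yes _) = 1ℚ
𝟙 (no  _) = 0ℚ

𝟙-yes : {P : Set} (d : Dec P) → P → 𝟙 d ≡ 1ℚ
𝟙-yes (yes _) _ = refl
𝟙-yes (no ¬p) p = ⊥-elim (¬p p)

𝟙-no : {P : Set} (d : Dec P) → ¬ P → 𝟙 d ≡ 0ℚ
𝟙-no (yes p) ¬p = ⊥-elim (¬p p)
𝟙-no (no _)  _  = refl

𝟙-⇔ : {P Q : Set} (d : Dec P) (e : Dec Q) → (P → Q) → (Q → P) → 𝟙 d ≡ 𝟙 e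
𝟙-⇔ (yes p) e f g = sym (𝟙-yes e (f p))
𝟙-⇔ (no ¬p) e f g = sym (𝟙-no e (¬p ∘ g))

𝟙-× : {P Q : Set} (d : Dec P) (e : Dec Q) → 𝟙 (d ×-dec e) ≡ 𝟙 d * 𝟙 e
𝟙-× (yes _) (yes _) = refl
𝟙-× (yes _) (no _)  = refl
𝟙-× (no _)  (yes _) = refl
𝟙-× (no _)  (no _)  = refl

𝟙-¬ : {P : Set} (d : Dec P) → 𝟙 (¬? d) ≡ 1ℚ - 𝟙 d
𝟙-¬ (yes _) = refl
𝟙-¬ (no _)  = refl

𝟙-cong : {P : Set} (d : Dec P) {x y : ℚ} → (P → x ≡ y) → 𝟙 d * x ≡ 𝟙 d * y
𝟙-cong (yes p) h = cong (1ℚ *_) (h p)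
𝟙-cong (no _) {x} {y} h = trans (ℚ.*-zeroˡ x) (sym (ℚ.*-zeroˡ y))

∑ ∏ : List A → (A → ℚ) → ℚ
∑ []       f = 0ℚ
∑ (x ∷ xs) f = f x + ∑ xs f
∏ []       f = 1ℚ
∏ (x ∷ xs) f = f x * ∏ xs f

∑-cong : (xs : List A) {f g : A → ℚ} → (∀ {x} → x ∈ xs → f x ≡ g x) → ∑ xs f ≡ ∑ xs g
∑-cong []       h = refl
∑-cong (x ∷ xs) h = cong₂ _+_ (h (here refl)) (∑-cong xs (h ∘ there))

∏-cong : (xs : List A) {f g : A → ℚ} → (∀ {x} → x ∈ xs → f x ≡ g x) → ∏ xs f ≡ ∏ xs g
∏-cong []       h = refl
∏-cong (x ∷ xs) h = cong₂ _*_ (h (here refl)) (∏-cong xs (h ∘ there))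

∑-0 : (xs : List A) → ∑ xs (λ _ → 0ℚ) ≡ 0ℚ
∑-0 []       = refl
∑-0 (x ∷ xs) = trans (ℚ.+-identityˡ _) (∑-0 xs)

∑-+ : (xs : List A) (f g : A → ℚ) → ∑ xs (λ x → f x + g x) ≡ ∑ xs f + ∑ xs g
∑-+ []       f g = refl
∑-+ (x ∷ xs) f g = trans (cong (_+_ (f x + g x)) (∑-+ xs f g))
  (solve 4 (λ a b c d → (a :+ b) :+ (c :+ d) := (a :+ c) :+ (b :+ d)) refl (f x) (g x) (∑ xs f) (∑ xs g))

∑-*ˡ : (xs : List A) (c : ℚ) (f : A → ℚ) → ∑ xs (λ x → c * f x) ≡ c * ∑ xs f
∑-*ˡ []       c f = sym (ℚ.*-zeroʳ c)
∑-*ˡ (x ∷ xs) c f = trans (cong (_+_ (c * f x)) (∑-*ˡ xs c f)) (sym (ℚ.*-distribˡ-+ c (f x) (∑ xs f)))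

∑-*ʳ : (xs : List A) (c : ℚ) (f : A → ℚ) → ∑ xs (λ x → f x * c) ≡ ∑ xs f * c
∑-*ʳ xs c f = trans (∑-cong xs (λ {x} _ → ℚ.*-comm (f x) c)) (trans (∑-*ˡ xs c f) (ℚ.*-comm c _))

∑-swap : (xs : List A) (ys : List B) (f : A → B → ℚ) →
  ∑ xs (λ x → ∑ ys (f x)) ≡ ∑ ys (λ y → ∑ xs (λ x → f x y))
∑-swap []       ys f = sym (∑-0 ys)
∑-swap (x ∷ xs) ys f = trans (cong (_+_ (∑ ys (f x))) (∑-swap xs ys f)) (sym (∑-+ ys (f x) _))

∑-++ : (xs ys : List A) (f : A → ℚ) → ∑ (xs ++ ys) f ≡ ∑ xs f + ∑ ys f
∑-++ []       ys f = sym (ℚ.+-identityˡ _)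
∑-++ (x ∷ xs) ys f = trans (cong (_+_ (f x)) (∑-++ xs ys f)) (sym (ℚ.+-assoc (f x) _ _))

∏-++ : (xs ys : List A) (f : A → ℚ) → ∏ (xs ++ ys) f ≡ ∏ xs f * ∏ ys f
∏-++ []       ys f = sym (ℚ.*-identityˡ _)
∏-++ (x ∷ xs) ys f = trans (cong (f x *_) (∏-++ xs ys f)) (sym (ℚ.*-assoc (f x) _ _))

∑-map : (h : A → B) (xs : List A) (f : B → ℚ) → ∑ (map h xs) f ≡ ∑ xs (f ∘ h)
∑-map h []       f = refl
∑-map h (x ∷ xs) f = cong (_+_ (f (h x))) (∑-map h xs f)

∏-map : (h : A → B) (xs : List A) (f : B → ℚ) → ∏ (map h xs) f ≡ ∏ xs (f ∘ h)
∏-map h []       f = refl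
∏-map h (x ∷ xs) f = cong (f (h x) *_) (∏-map h xs f)

∑-cartesian : (xs : List A) (ys : List B) (f : A × B → ℚ) →
  ∑ (cartesianProduct xs ys) f ≡ ∑ xs (λ x → ∑ ys (λ y → f (x , y)))
∑-cartesian []       ys f = refl
∑-cartesian (x ∷ xs) ys f = trans (∑-++ (map (x ,_) ys) _ f)
  (cong₂ _+_ (∑-map (x ,_) ys f) (∑-cartesian xs ys f))

∑-product : (xs : List A) (ys : List B) (f : A → ℚ) (g : B → ℚ) →
  ∑ xs (λ x → ∑ ys (λ y → f x * g y)) ≡ ∑ xs f * ∑ ys g
∑-product xs ys f g = trans (∑-cong xs (λ {x} _ → ∑-*ˡ ys (f x) g)) (∑-*ʳ xs (∑ ys g) f)

∑-↭ : {xs ys : List A} (f : A → ℚ) → xs ↭ ys → ∑ xs f ≡ ∑ ys f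
∑-↭ f ↭.refl         = refl
∑-↭ f (prep x p)     = cong (_+_ (f x)) (∑-↭ f p)
∑-↭ f (swap x y p)   = trans (cong (λ s → f x + (f y + s)) (∑-↭ f p))
  (solve 3 (λ a b c → a :+ (b :+ c) := b :+ (a :+ c)) refl (f x) (f y) _)
∑-↭ f (↭.trans p q)  = trans (∑-↭ f p) (∑-↭ f q)

∏-↭ : {xs ys : List A} (f : A → ℚ) → xs ↭ ys → ∏ xs f ≡ ∏ ys f
∏-↭ f ↭.refl         = refl
∏-↭ f (prep x p)     = cong (f x *_) (∏-↭ f p)
∏-↭ f (swap x y p)   = trans (cong (λ s → f x * (f y * s)) (∏-↭ f p))
  (solve 3 (λ a b c → a :* (b :* c) := b :* (a :* c)) refl (f x) (f y) _)
∏-↭ f (↭.trans p q)  = trans (∏-↭ f p) (∏-↭ f q)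

module _ (_≟_ : DecidableEquality A) where

  ∑-δ-∉ : (xs : List A) (a : A) (f : A → ℚ) → a ∉ xs → ∑ xs (λ x → 𝟙 (a ≟ x) * f x) ≡ 0ℚ
  ∑-δ-∉ xs a f a∉ = trans (∑-cong xs (λ {x} x∈ →
      trans (cong (_* f x) (𝟙-no (a ≟ x) (λ { refl → a∉ x∈ }))) (ℚ.*-zeroˡ (f x)))) (∑-0 xs)

  ∑-δ : {xs : List A} {a : A} (f : A → ℚ) → Unique xs → a ∈ xs → ∑ xs (λ x → 𝟙 (a ≟ x) * f x) ≡ f a
  ∑-δ {xs = x ∷ xs} {a} f (x≢ ∷ _) (here refl) = begin
      𝟙 (a ≟ a) * f a + ∑ xs (λ y → 𝟙 (a ≟ y) * f y)
    ≡⟨ cong₂ _+_ (cong (_* f a) (𝟙-yes (a ≟ a) refl)) (∑-δ-∉ xs a f (λ a∈ → All.lookup x≢ a∈ refl)) ⟩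
      1ℚ * f a + 0ℚ
    ≡⟨ trans (ℚ.+-identityʳ _) (ℚ.*-identityˡ _) ⟩
      f a ∎
    where open ≡-Reasoning
  ∑-δ {xs = x ∷ xs} {a} f (x≢ ∷ u) (there a∈) = begin
      𝟙 (a ≟ x) * f x + ∑ xs (λ y → 𝟙 (a ≟ y) * f y)
    ≡⟨ cong₂ _+_ (cong (_* f x) (𝟙-no (a ≟ x) (λ { refl → All.lookup x≢ a∈ refl }))) (∑-δ f u a∈) ⟩
      0ℚ * f x + f a
    ≡⟨ cong (_+ f a) (ℚ.*-zeroˡ (f x)) ⟩
      0ℚ + f a
    ≡⟨ ℚ.+-identityˡ _ ⟩
      f a ∎
    where open ≡-Reasoning

  -- Regroups a sum by the value of `φ`. With `φ` sending a vertex to its representative, a sum over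
  -- vertices becomes a sum over components, each weighted by its number of vertices on that side.
  ∑-fibre : (xs : List B) (ls : List A) (φ : B → A) (h : A → ℚ) → Unique ls → (∀ x → φ x ∈ ls) →
    ∑ xs (h ∘ φ) ≡ ∑ ls (λ l → ∑ xs (λ x → 𝟙 (φ x ≟ l)) * h l)
  ∑-fibre xs ls φ h u φ∈ = begin
      ∑ xs (h ∘ φ)
    ≡⟨ ∑-cong xs (λ {x} _ → sym (∑-δ h u (φ∈ x))) ⟩
      ∑ xs (λ x → ∑ ls (λ l → 𝟙 (φ x ≟ l) * h l))
    ≡⟨ ∑-swap xs ls _ ⟩
      ∑ ls (λ l → ∑ xs (λ x → 𝟙 (φ x ≟ l) * h l))
    ≡⟨ ∑-cong ls (λ {l} _ → ∑-*ʳ xs (h l) _) ⟩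
      ∑ ls (λ l → ∑ xs (λ x → 𝟙 (φ x ≟ l)) * h l) ∎
    where open ≡-Reasoning

-- The embedding ℕ→ℚ

-- Normalisation of a fraction does not compute for variable numerators, so the equation is checked
-- on unnormalised rationals, where it is plain integer arithmetic.
ℕ→ℚ-+ : ∀ a b → ℕ→ℚ (a ℕ.+ b) ≡ ℕ→ℚ a + ℕ→ℚ b
ℕ→ℚ-+ a b = ℚ.toℚᵘ-injective (begin
    ℚ.toℚᵘ (ℕ→ℚ (a ℕ.+ b))
  ≈⟨ ℚ.toℚᵘ-fromℚᵘ (ℚᵘ.mkℚᵘ (+ (a ℕ.+ b)) 0) ⟩
    ℚᵘ.mkℚᵘ (+ (a ℕ.+ b)) 0
  ≈⟨ ℚᵘ.*≡* (cong (ℤ._* + 1) (cong₂ ℤ._+_ (sym (ℤ.*-identityʳ (+ a))) (sym (ℤ.*-identityʳ (+ b))))) ⟩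
    ℚᵘ.mkℚᵘ (+ a) 0 ℚᵘ.+ ℚᵘ.mkℚᵘ (+ b) 0
  ≈⟨ ℚᵘ.+-cong (ℚ.toℚᵘ-fromℚᵘ (ℚᵘ.mkℚᵘ (+ a) 0)) (ℚ.toℚᵘ-fromℚᵘ (ℚᵘ.mkℚᵘ (+ b) 0)) ⟨
    ℚ.toℚᵘ (ℕ→ℚ a) ℚᵘ.+ ℚ.toℚᵘ (ℕ→ℚ b)
  ≈⟨ ℚ.toℚᵘ-homo-+ (ℕ→ℚ a) (ℕ→ℚ b) ⟨
    ℚ.toℚᵘ (ℕ→ℚ a + ℕ→ℚ b) ∎)
  where open ℚᵘ.≃-Reasoning

ℕ→ℚ-suc : ∀ a → ℕ→ℚ (suc a) ≡ 1ℚ + ℕ→ℚ a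
ℕ→ℚ-suc a = ℕ→ℚ-+ 1 a

ℕ→ℚ-* : ∀ a b → ℕ→ℚ (a ℕ.* b) ≡ ℕ→ℚ a * ℕ→ℚ b
ℕ→ℚ-* zero    b = sym (ℚ.*-zeroˡ (ℕ→ℚ b))
ℕ→ℚ-* (suc a) b = begin
    ℕ→ℚ (b ℕ.+ a ℕ.* b)
  ≡⟨ ℕ→ℚ-+ b (a ℕ.* b) ⟩
    ℕ→ℚ b + ℕ→ℚ (a ℕ.* b)
  ≡⟨ cong (_+_ (ℕ→ℚ b)) (ℕ→ℚ-* a b) ⟩
    ℕ→ℚ b + ℕ→ℚ a * ℕ→ℚ b
  ≡⟨ solve 2 (λ x y → y :+ x :* y := (con 1ℚ :+ x) :* y) refl (ℕ→ℚ a) (ℕ→ℚ b) ⟩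
    (1ℚ + ℕ→ℚ a) * ℕ→ℚ b
  ≡⟨ cong (_* ℕ→ℚ b) (sym (ℕ→ℚ-suc a)) ⟩
    ℕ→ℚ (suc a) * ℕ→ℚ b ∎
  where open ≡-Reasoning

ℕ→ℚ-suc≢0 : ∀ a → ℕ→ℚ (suc a) ≢ 0ℚ
ℕ→ℚ-suc≢0 a eq = ℚ.<-irrefl (sym eq) (ℚ.positive⁻¹ (ℕ→ℚ (suc a)) {{ℚ.normalize-pos (suc a) 1}})

ℕ→ℚ≡0⇒≡0 : ∀ a → ℕ→ℚ a ≡ 0ℚ → a ≡ 0
ℕ→ℚ≡0⇒≡0 zero    _  = refl
ℕ→ℚ≡0⇒≡0 (suc a) eq = ⊥-elim (ℕ→ℚ-suc≢0 a eq)

∑-1 : (xs : List A) → ∑ xs (λ _ → 1ℚ) ≡ ℕ→ℚ (length xs)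
∑-1 []       = refl
∑-1 (x ∷ xs) = trans (cong (_+_ 1ℚ) (∑-1 xs)) (sym (ℕ→ℚ-suc (length xs)))

length-filter : {P : A → Set} (P? : Decidable P) (xs : List A) →
  ℕ→ℚ (length (filter P? xs)) ≡ ∑ xs (λ x → 𝟙 (P? x))
length-filter P? [] = refl
length-filter P? (x ∷ xs) with P? x
... | yes _ = trans (ℕ→ℚ-suc (length (filter P? xs))) (cong (_+_ 1ℚ) (length-filter P? xs))
... | no  _ = trans (length-filter P? xs) (sym (ℚ.+-identityˡ _))

-- Total, with default value 0 at 0, so that weights can be inverted inside formulas before they are
-- known to be nonzero.
inv : ℚ → ℚ
inv q with q ℚ.≟ 0ℚ
... | yes _  = 0ℚ
... | no q≢0 = ℚ.1/_ q {{ℚ.≢-nonZero q≢0}}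

inv-* : ∀ {q} → q ≢ 0ℚ → q * inv q ≡ 1ℚ
inv-* {q} q≢0 with q ℚ.≟ 0ℚ
... | yes q≡0 = ⊥-elim (q≢0 q≡0)
... | no q≢0′ = ℚ.*-inverseʳ q {{ℚ.≢-nonZero q≢0′}}

*-cancelˡ : ∀ {q} x y → q ≢ 0ℚ → q * x ≡ q * y → x ≡ y
*-cancelˡ {q} x y q≢0 eq = begin
    x                  ≡⟨ expand x ⟩
    inv q * (q * x)    ≡⟨ cong (inv q *_) eq ⟩
    inv q * (q * y)    ≡⟨ sym (expand y) ⟩
    y                  ∎
  where
  open ≡-Reasoning
  expand : ∀ z → z ≡ inv q * (q * z)
  expand z = sym (trans (solve 3 (λ i q z → i :* (q :* z) := (q :* i) :* z) refl (inv q) q z)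
    (trans (cong (_* z) (inv-* q≢0)) (ℚ.*-identityˡ z)))

-- The forest formula

module ForestFormula {A : Set} (m n : ℚ) where

  weight : (a b : A → ℚ) → A → ℚ
  weight a b l = a l * n + b l * m

  share : (a b : A → ℚ) → A → ℚ
  share a b l = a l * b l * inv (weight a b l)

  defect : (a b : A → ℚ) → List A → ℚ
  defect a b ls = 1ℚ - ∑ ls (share a b)

  value : (a b : A → ℚ) → List A → ℚ
  value a b ls = ∏ ls (weight a b) * defect a b ls

  -- The factor by which ∏ weight is multiplied to give the value after components k and l are merged
  -- (t is the defect before merging); see value-merge.
  mergeFactor : (a b : A → ℚ) → ℚ → A → A → ℚ
  mergeFactor a b t k l =
    (r k + r l) * t + a k * b k * (r k * r k) + a l * b l * (r l * r l) - (a k * b l + a l * b k) * (r k * r l)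
    where
    r : A → ℚ
    r j = inv (weight a b j)

  value-merge : (a b a′ b′ : A → ℚ) {ls rest : List A} {i j : A} → ls ↭ i ∷ j ∷ rest →
    weight a b i ≢ 0ℚ → weight a b j ≢ 0ℚ → weight a′ b′ i ≢ 0ℚ →
    a′ i ≡ a i + a j → b′ i ≡ b i + b j →
    (∀ {l} → l ∈ rest → a′ l ≡ a l) → (∀ {l} → l ∈ rest → b′ l ≡ b l) →
    value a′ b′ (i ∷ rest) ≡ ∏ ls (weight a b) * mergeFactor a b (defect a b ls) i j
  value-merge a b a′ b′ {ls} {rest} {i} {j} p xi≢0 xj≢0 x′≢0 a′i b′i a′≡ b′≡ = begin
      (x′ * ∏ rest (weight a′ b′)) * (1ℚ - (a′ i * b′ i * inv x′ + ∑ rest (share a′ b′)))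
    ≡⟨ cong₂ (λ R s → (x′ * R) * (1ℚ - (a′ i * b′ i * inv x′ + s)))
         (∏-cong rest (λ l∈ → cong₂ (λ u v → u * n + v * m) (a′≡ l∈) (b′≡ l∈)))
         (∑-cong rest (λ l∈ → cong₂ (λ u v → u * v * inv (u * n + v * m)) (a′≡ l∈) (b′≡ l∈))) ⟩
      (x′ * R) * (1ℚ - (a′ i * b′ i * inv x′ + s))
    ≡⟨ solve 5 (λ x R q ρ s → (x :* R) :* (con 1ℚ :- (q :* ρ :+ s)) := R :* (x :* (con 1ℚ :- s) :- q :* (x :* ρ)))
         refl x′ R (a′ i * b′ i) (inv x′) s ⟩
      R * (x′ * (1ℚ - s) - a′ i * b′ i * (x′ * inv x′))
    ≡⟨ cong (λ e → R * (x′ * (1ℚ - s) - a′ i * b′ i * e)) (inv-* x′≢0) ⟩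
      R * (x′ * (1ℚ - s) - a′ i * b′ i * 1ℚ)
    ≡⟨ cong₂ (λ u v → R * ((u * n + v * m) * (1ℚ - s) - u * v * 1ℚ)) a′i b′i ⟩
      R * (((ai + aj) * n + (bi + bj) * m) * (1ℚ - s) - (ai + aj) * (bi + bj) * 1ℚ)
    ≡⟨ solve 8 (λ R s ai aj bi bj n m →
           R :* (((ai :+ aj) :* n :+ (bi :+ bj) :* m) :* (con 1ℚ :- s) :- (ai :+ aj) :* (bi :+ bj) :* con 1ℚ)
        := R :* (((ai :* n :+ bi :* m) :* con 1ℚ :+ (aj :* n :+ bj :* m) :* con 1ℚ) :* (con 1ℚ :- s)
                 :- (ai :+ aj) :* (bi :+ bj) :* (con 1ℚ :* con 1ℚ)))
         refl R s ai aj bi bj n m ⟩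
      F 1ℚ 1ℚ
    -- The arguments of `F` are slots for two factors equal to 1. Filling them with `xi * ri` and
    -- `xj * rj` allows `xi * xj` to be pulled out, which restores the product of weights before the
    -- merge.
    ≡⟨ sym (cong₂ F (inv-* xi≢0) (inv-* xj≢0)) ⟩
      F (xi * ri) (xj * rj)
    ≡⟨ solve 10 (λ xi xj ri rj R s ai aj bi bj →
           R :* ((xi :* (xj :* rj) :+ xj :* (xi :* ri)) :* (con 1ℚ :- s)
                 :- (ai :+ aj) :* (bi :+ bj) :* ((xi :* ri) :* (xj :* rj)))
        := (xi :* (xj :* R)) :* ((ri :+ rj) :* (con 1ℚ :- (ai :* bi :* ri :+ (aj :* bj :* rj :+ s)))
              :+ ai :* bi :* (ri :* ri) :+ aj :* bj :* (rj :* rj) :- (ai :* bj :+ aj :* bi) :* (ri :* rj)))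
         refl xi xj ri rj R s ai aj bi bj ⟩
      (xi * (xj * R)) * mergeFactor a b (1ℚ - (share a b i + (share a b j + s))) i j
    ≡⟨ sym (cong₂ (λ P s → P * mergeFactor a b (1ℚ - s) i j) (∏-↭ (weight a b) p) (∑-↭ (share a b) p)) ⟩
      ∏ ls (weight a b) * mergeFactor a b (defect a b ls) i j ∎
    where
    open ≡-Reasoning
    x′ xi xj ri rj ai aj bi bj R s : ℚ
    x′ = weight a′ b′ i
    xi = weight a b i
    xj = weight a b j
    ri = inv xi
    rj = inv xj
    ai = a i
    aj = a j
    bi = b i
    bj = b j
    R = ∏ rest (weight a b)
    s = ∑ rest (share a b)
    F : ℚ → ℚ → ℚ
    F ei ej = R * ((xi * ej + xj * ei) * (1ℚ - s) - (ai + aj) * (bi + bj) * (ei * ej))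

  module _ (_≟_ : DecidableEquality A) (a b : A → ℚ) {ls : List A} (uniq : Unique ls)
           (weight≢0 : ∀ {l} → l ∈ ls → weight a b l ≢ 0ℚ)
           (m≢0 : m ≢ 0ℚ) (n≢0 : n ≢ 0ℚ) (∑a : ∑ ls a ≡ m) (∑b : ∑ ls b ≡ n) where

    open ≡-Reasoning

    private
      r : A → ℚ
      r l = inv (weight a b l)

      c S t α β : ℚ
      c = ∑ ls (λ _ → 1ℚ)
      S = ∑ ls (share a b)
      t = defect a b ls
      α = ∑ ls (λ l → a l * a l * r l)
      β = ∑ ls (λ l → b l * b l * r l)

      -- Combining two sums with the coefficients `n` and `m` makes the weight appear, and it
      -- cancels against its reciprocal. This is how every sum containing `r` is evaluated.
      ∑-weighted : (f g h : A → ℚ) → (∀ l → f l * n + g l * m ≡ weight a b l * r l * h l) →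
        ∑ ls f * n + ∑ ls g * m ≡ ∑ ls h
      ∑-weighted f g h eq = begin
          ∑ ls f * n + ∑ ls g * m
        ≡⟨ sym (cong₂ _+_ (∑-*ʳ ls n f) (∑-*ʳ ls m g)) ⟩
          ∑ ls (λ l → f l * n) + ∑ ls (λ l → g l * m)
        ≡⟨ sym (∑-+ ls _ _) ⟩
          ∑ ls (λ l → f l * n + g l * m)
        ≡⟨ ∑-cong ls (λ {l} l∈ → trans (eq l) (trans (cong (_* h l) (inv-* (weight≢0 l∈))) (ℚ.*-identityˡ (h l)))) ⟩
          ∑ ls h ∎

      -- From a² n + a b m = a (a n + b m): dividing by the weight and summing gives
      -- `α * n + S * m ≡ m`.
      α-eq : α * n ≡ m * t
      α-eq = begin
          α * n
        ≡⟨ solve 4 (λ α n S m → α :* n := (α :* n :+ S :* m) :- S :* m) refl α n S m ⟩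
          (α * n + S * m) - S * m
        ≡⟨ cong (_- S * m) (trans (∑-weighted _ (share a b) a (λ l →
             solve 5 (λ a b r n m → a :* a :* r :* n :+ a :* b :* r :* m := (a :* n :+ b :* m) :* r :* a)
               refl (a l) (b l) (r l) n m)) ∑a) ⟩
          m - S * m
        ≡⟨ solve 2 (λ S m → m :- S :* m := m :* (con 1ℚ :- S)) refl S m ⟩
          m * t ∎

      β-eq : β * m ≡ n * t
      β-eq = begin
          β * m
        ≡⟨ solve 4 (λ β n S m → β :* m := (S :* n :+ β :* m) :- S :* n) refl β n S m ⟩
          (S * n + β * m) - S * n
        ≡⟨ cong (_- S * n) (trans (∑-weighted (share a b) _ b (λ l →
             solve 5 (λ a b r n m → a :* b :* r :* n :+ b :* b :* r :* m := (a :* n :+ b :* m) :* r :* b)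
               refl (a l) (b l) (r l) n m)) ∑b) ⟩
          n - S * n
        ≡⟨ solve 2 (λ S m → m :- S :* m := m :* (con 1ℚ :- S)) refl S n ⟩
          n * t ∎

      αβ≡t² : α * β ≡ t * t
      αβ≡t² = *-cancelˡ _ _ n≢0 (*-cancelˡ _ _ m≢0 (begin
          m * (n * (α * β))
        ≡⟨ solve 4 (λ m n α β → m :* (n :* (α :* β)) := (α :* n) :* (β :* m)) refl m n α β ⟩
          (α * n) * (β * m)
        ≡⟨ cong₂ _*_ α-eq β-eq ⟩
          (m * t) * (n * t)
        ≡⟨ solve 3 (λ m n t → (m :* t) :* (n :* t) := m :* (n :* (t :* t))) refl m n t ⟩
          m * (n * (t * t)) ∎))

      pairTerm : A → A → ℚ
      pairTerm k l = a k * b l * mergeFactor a b t k l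

      ∑∑-+ : (f g : A → A → ℚ) → ∑ ls (λ k → ∑ ls (λ l → f k l + g k l)) ≡
        ∑ ls (λ k → ∑ ls (f k)) + ∑ ls (λ k → ∑ ls (g k))
      ∑∑-+ f g = trans (∑-cong ls (λ {k} _ → ∑-+ ls (f k) (g k))) (∑-+ ls _ _)

      -- Expanded, `pairTerm k l` is a sum of four products of a function of `k` and a function of
      -- `l`, so the double sum splits into products of single sums. The first two combine by
      -- `∑-weighted` to `t * c + S`; the other two are `- α * β` and `- S * S`.
      ∑-all : ∑ ls (λ k → ∑ ls (pairTerm k)) ≡ t * c + S - t * t - S * S
      ∑-all = begin
          ∑ ls (λ k → ∑ ls (pairTerm k))
        ≡⟨ ∑-cong ls (λ {k} _ → ∑-cong ls (λ {l} _ →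
             solve 7 (λ ak bk rk al bl rl t →
                 ak :* bl :* ((rk :+ rl) :* t :+ ak :* bk :* (rk :* rk) :+ al :* bl :* (rl :* rl)
                   :- (ak :* bl :+ al :* bk) :* (rk :* rl))
               := ak :* (t :* rk :+ bk :* ak :* rk :* rk) :* bl :+ (ak :* (bl :* (t :* rl :+ al :* bl :* rl :* rl))
                   :+ (:- (ak :* ak :* rk) :* (bl :* bl :* rl) :+ :- (ak :* bk :* rk) :* (al :* bl :* rl))))
               refl (a k) (b k) (r k) (a l) (b l) (r l) t)) ⟩
          ∑ ls (λ k → ∑ ls (λ l → u k * b l + (a k * v l + (- (a k * a k * r k) * (b l * b l * r l) + - share a b k * share a b l))))
        ≡⟨ trans (∑∑-+ (λ k l → u k * b l) _) (cong (_+_ (∑ ls (λ k → ∑ ls (λ l → u k * b l))))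
             (trans (∑∑-+ (λ k l → a k * v l) _) (cong (_+_ (∑ ls (λ k → ∑ ls (λ l → a k * v l))))
               (∑∑-+ (λ k l → - (a k * a k * r k) * (b l * b l * r l)) (λ k l → - share a b k * share a b l))))) ⟩
          ∑ ls (λ k → ∑ ls (λ l → u k * b l)) + (∑ ls (λ k → ∑ ls (λ l → a k * v l)) +
            (∑ ls (λ k → ∑ ls (λ l → - (a k * a k * r k) * (b l * b l * r l))) + ∑ ls (λ k → ∑ ls (λ l → - share a b k * share a b l))))
        ≡⟨ cong₂ _+_ (∑-product ls ls u b) (cong₂ _+_ (∑-product ls ls a v)
             (cong₂ _+_ (trans (∑-product ls ls _ _) (cong (_* β) (∑-neg _))) (trans (∑-product ls ls _ _) (cong (_* S) (∑-neg _))))) ⟩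
          ∑ ls u * ∑ ls b + (∑ ls a * ∑ ls v + (- α * β + - S * S))
        ≡⟨ cong₂ (λ p q → ∑ ls u * p + (q * ∑ ls v + (- α * β + - S * S))) ∑b ∑a ⟩
          ∑ ls u * n + (m * ∑ ls v + (- α * β + - S * S))
        ≡⟨ solve 7 (λ u n m v α β S → u :* n :+ (m :* v :+ (:- α :* β :+ :- S :* S)) := (u :* n :+ v :* m) :- α :* β :- S :* S)
             refl (∑ ls u) n m (∑ ls v) α β S ⟩
          (∑ ls u * n + ∑ ls v * m) - α * β - S * S
        ≡⟨ cong₂ (λ p q → p - q - S * S)
             (trans (∑-weighted u v _ (λ l →
                solve 6 (λ a b r t n m → a :* (t :* r :+ b :* a :* r :* r) :* n :+ b :* (t :* r :+ a :* b :* r :* r) :* m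
                    := (a :* n :+ b :* m) :* r :* (t :* con 1ℚ :+ a :* b :* r)) refl (a l) (b l) (r l) t n m))
               (trans (∑-+ ls _ _) (cong (_+ S) (∑-*ˡ ls t _)))) αβ≡t² ⟩
          t * c + S - t * t - S * S ∎
        where
        u v : A → ℚ
        u k = a k * (t * r k + b k * a k * r k * r k)
        v l = b l * (t * r l + a l * b l * r l * r l)
        ∑-neg : (f : A → ℚ) → ∑ ls (λ l → - f l) ≡ - ∑ ls f
        ∑-neg f = trans (∑-cong ls (λ {l} _ → solve 1 (λ x → :- x := :- con 1ℚ :* x) refl (f l)))
          (trans (∑-*ˡ ls (- 1ℚ) f) (solve 1 (λ x → :- con 1ℚ :* x := :- x) refl (∑ ls f)))

      ∑-diagonal : ∑ ls (λ l → pairTerm l l) ≡ (t + t) * S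
      ∑-diagonal = trans (∑-cong ls (λ {l} _ →
        solve 4 (λ a b r t → a :* b :* ((r :+ r) :* t :+ a :* b :* (r :* r) :+ a :* b :* (r :* r)
            :- (a :* b :+ a :* b) :* (r :* r)) := (t :+ t) :* (a :* b :* r)) refl (a l) (b l) (r l) t))
        (∑-*ˡ ls (t + t) (share a b))

    -- The diagonal contributes 2 t S, so removing it from the full sum leaves t c + S - (t + S)².
    -- As t + S = 1, this is t c - t.
    ∑-mergeFactor : ∑ ls (λ k → ∑ ls (λ l → 𝟙 (¬? (k ≟ l)) * (a k * b l * mergeFactor a b t k l))) ≡ (c - 1ℚ) * t
    ∑-mergeFactor = begin
        ∑ ls (λ k → ∑ ls (λ l → 𝟙 (¬? (k ≟ l)) * pairTerm k l))
      ≡⟨ ∑-cong ls (λ {k} _ → ∑-cong ls (λ {l} _ → trans (cong (_* pairTerm k l) (𝟙-¬ (k ≟ l)))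
           (solve 2 (λ d p → (con 1ℚ :- d) :* p := p :+ :- con 1ℚ :* (d :* p)) refl (𝟙 (k ≟ l)) (pairTerm k l)))) ⟩
        ∑ ls (λ k → ∑ ls (λ l → pairTerm k l + - 1ℚ * (𝟙 (k ≟ l) * pairTerm k l)))
      ≡⟨ ∑∑-+ _ _ ⟩
        ∑ ls (λ k → ∑ ls (pairTerm k)) + ∑ ls (λ k → ∑ ls (λ l → - 1ℚ * (𝟙 (k ≟ l) * pairTerm k l)))
      ≡⟨ cong₂ _+_ ∑-all (trans (∑-cong ls (λ {k} k∈ → trans (∑-*ˡ ls (- 1ℚ) _)
           (cong (- 1ℚ *_) (∑-δ _≟_ (pairTerm k) uniq k∈)))) (trans (∑-*ˡ ls (- 1ℚ) _) (cong (- 1ℚ *_) ∑-diagonal))) ⟩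
        (t * c + S - t * t - S * S) + - 1ℚ * ((t + t) * S)
      ≡⟨ solve 2 (λ S c → let t = con 1ℚ :- S in
             (t :* c :+ S :- t :* t :- S :* S) :+ :- con 1ℚ :* ((t :+ t) :* S) := (c :- con 1ℚ) :* t) refl S c ⟩
        (c - 1ℚ) * t ∎

-- Lists without repetition

module _ {A : Set} where

  Unique-resp-↭ : {xs ys : List A} → xs ↭ ys → Unique xs → Unique ys
  Unique-resp-↭ p = ↭ₛ.Unique-resp-↭ (setoid A) (↭⇒↭ₛ p)

  extract : {x : A} {xs : List A} → x ∈ xs → ∃ λ ys → xs ↭ x ∷ ys
  extract {x} x∈ with ys , zs , refl ← ∈-∃++ x∈ = ys ++ zs , shift x ys zs

  -- Brings the representatives of two components to the front before they are merged; sums and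
  -- products over the representatives do not see the reordering.
  extract₂ : {x y : A} {xs : List A} → x ∈ xs → y ∈ xs → x ≢ y → ∃ λ zs → xs ↭ x ∷ y ∷ zs
  extract₂ x∈ y∈ x≢y with ys , p ← extract x∈ with ∈-resp-↭ p y∈
  ... | here y≡x  = ⊥-elim (x≢y (sym y≡x))
  ... | there y∈′ with zs , q ← extract y∈′ = zs , ↭.trans p (prep _ q)

-- Adding and deleting an edge

module _ {m n : ℕ} where

  _≟ᵥ_ : DecidableEquality (Vertex m n)
  _≟ᵥ_ = Sum.≡-dec Fin._≟_ Fin._≟_

  _≟ₑ_ : DecidableEquality (Fin m × Fin n)
  _≟ₑ_ = Product.≡-dec Fin._≟_ Fin._≟_

  _∋?_,_ : (E : EdgeSet m n) (i : Fin m) (j : Fin n) → Dec (E ∋ₑ i , j)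
  E ∋? i , j = lookup (lookup E i) j Bool.≟ true

  _⊆?_ : (E F : EdgeSet m n) → Dec (E ⊆ₑ F)
  E ⊆? F = Fin.all? λ i → Fin.all? λ j → →? (E ∋? i , j) (F ∋? i , j)
    where
    →? : {P Q : Set} → Dec P → Dec Q → Dec (P → Q)
    →? _       (yes q) = yes λ _ → q
    →? (yes p) (no ¬q) = no λ f → ¬q (f p)
    →? (no ¬p) (no _)  = yes λ p → ⊥-elim (¬p p)

  set : Bool → EdgeSet m n → Fin m → Fin n → EdgeSet m n
  set b E i j = E [ i ]%= (_[ j ]≔ b)

  _⊕_,_ _⊖_,_ : EdgeSet m n → Fin m → Fin n → EdgeSet m n
  E ⊕ i , j = set true E i j
  E ⊖ i , j = set false E i j

  lookup-set : ∀ b E i j → lookup (lookup (set b E i j) i) j ≡ b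
  lookup-set b E i j = trans (cong (λ r → lookup r j) (Vec.lookup∘updateAt i E)) (Vec.lookup∘update j (lookup E i) b)

  lookup-set′ : ∀ b E i j k l → (i , j) ≢ (k , l) → lookup (lookup (set b E i j) k) l ≡ lookup (lookup E k) l
  lookup-set′ b E i j k l ≢ with k Fin.≟ i
  ... | no k≢i = cong (λ r → lookup r l) (Vec.lookup∘updateAt′ k i k≢i E)
  ... | yes refl = trans (cong (λ r → lookup r l) (Vec.lookup∘updateAt i E))
    (Vec.lookup∘update′ {i = l} {j} (λ { refl → ≢ refl }) (lookup E i) b)

  ⊕-∋ : ∀ E i j → (E ⊕ i , j) ∋ₑ i , j
  ⊕-∋ = lookup-set true

  ⊆-⊕ : ∀ E i j → E ⊆ₑ (E ⊕ i , j)
  ⊆-⊕ E i j k l kl∈ with (i , j) ≟ₑ (k , l)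
  ... | yes refl = ⊕-∋ E i j
  ... | no ≢     = trans (lookup-set′ true E i j k l ≢) kl∈

  ⊕-∋⁻ : ∀ E i j k l → (E ⊕ i , j) ∋ₑ k , l → (i , j) ≡ (k , l) ⊎ E ∋ₑ k , l
  ⊕-∋⁻ E i j k l kl∈ with (i , j) ≟ₑ (k , l)
  ... | yes ≡ = inj₁ ≡
  ... | no ≢  = inj₂ (trans (sym (lookup-set′ true E i j k l ≢)) kl∈)

  ⊕-⊆ : ∀ {E T i j} → E ⊆ₑ T → T ∋ₑ i , j → (E ⊕ i , j) ⊆ₑ T
  ⊕-⊆ {E} {T} {i} {j} E⊆T ij∈ k l kl∈ with ⊕-∋⁻ E i j k l kl∈
  ... | inj₁ refl = ij∈
  ... | inj₂ kl∈E = E⊆T k l kl∈E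

  ⊖-∋ : ∀ E i j k l → (i , j) ≢ (k , l) → E ∋ₑ k , l → (E ⊖ i , j) ∋ₑ k , l
  ⊖-∋ E i j k l ≢ kl∈ = trans (lookup-set′ false E i j k l ≢) kl∈

  ⊖-∌ : ∀ E i j → ¬ (E ⊖ i , j) ∋ₑ i , j
  ⊖-∌ E i j ij∈ with () ← trans (sym (lookup-set false E i j)) ij∈

  ⊖-⊆ : ∀ E i j → (E ⊖ i , j) ⊆ₑ E
  ⊖-⊆ E i j k l kl∈ with (i , j) ≟ₑ (k , l)
  ... | yes refl = ⊥-elim (⊖-∌ E i j kl∈)
  ... | no ≢     = trans (sym (lookup-set′ false E i j k l ≢)) kl∈

-- Walks

  Reach : EdgeSet m n → Vertex m n → Vertex m n → Set
  Reach E = Star (Adj E)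

  Adj-sym : ∀ (E : EdgeSet m n) {u v} → Adj E u v → Adj E v u
  Adj-sym E {inj₁ _} {inj₂ _} a = a
  Adj-sym E {inj₂ _} {inj₁ _} a = a

  Adj-mono : {E F : EdgeSet m n} → E ⊆ₑ F → ∀ {u v} → Adj E u v → Adj F u v
  Adj-mono E⊆F {inj₁ i} {inj₂ j} a = E⊆F i j a
  Adj-mono E⊆F {inj₂ j} {inj₁ i} a = E⊆F i j a

  Reach-sym : ∀ (E : EdgeSet m n) {u v} → Reach E u v → Reach E v u
  Reach-sym E = Star.reverse (Adj-sym E)

  Reach-mono : {E F : EdgeSet m n} → E ⊆ₑ F → ∀ {u v} → Reach E u v → Reach F u v
  Reach-mono E⊆F = Star.map (Adj-mono E⊆F)

  Ends : Fin m → Fin n → Vertex m n → Vertex m n → Set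
  Ends i j u v = (u ≡ inj₁ i × v ≡ inj₂ j) ⊎ (u ≡ inj₂ j × v ≡ inj₁ i)

  Adj-⊕⁻ : ∀ E i j {u v} → Adj (E ⊕ i , j) u v → Ends i j u v ⊎ Adj E u v
  Adj-⊕⁻ E i j {inj₁ k} {inj₂ l} a with ⊕-∋⁻ E i j k l a
  ... | inj₁ refl = inj₁ (inj₁ (refl , refl))
  ... | inj₂ a′   = inj₂ a′
  Adj-⊕⁻ E i j {inj₂ l} {inj₁ k} a with ⊕-∋⁻ E i j k l a
  ... | inj₁ refl = inj₁ (inj₂ (refl , refl))
  ... | inj₂ a′   = inj₂ a′

  Adj-⊖⁺ : ∀ E i j {u v} → ¬ Ends i j u v → Adj E u v → Adj (E ⊖ i , j) u v
  Adj-⊖⁺ E i j {inj₁ k} {inj₂ l} ¬e a = ⊖-∋ E i j k l (λ { refl → ¬e (inj₁ (refl , refl)) }) a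
  Adj-⊖⁺ E i j {inj₂ l} {inj₁ k} ¬e a = ⊖-∋ E i j k l (λ { refl → ¬e (inj₂ (refl , refl)) }) a

  Reach-⊕⁻ : ∀ E i j {u v} → Reach (E ⊕ i , j) u v →
    Reach E u v ⊎ (Reach E u (inj₁ i) × Reach E (inj₂ j) v) ⊎ (Reach E u (inj₂ j) × Reach E (inj₁ i) v)
  Reach-⊕⁻ E i j ε = inj₁ ε
  Reach-⊕⁻ E i j (a ◅ p) with Adj-⊕⁻ E i j a | Reach-⊕⁻ E i j p
  ... | inj₂ a′                   | inj₁ q               = inj₁ (a′ ◅ q)
  ... | inj₂ a′                   | inj₂ (inj₁ (q , q′)) = inj₂ (inj₁ (a′ ◅ q , q′))
  ... | inj₂ a′                   | inj₂ (inj₂ (q , q′)) = inj₂ (inj₂ (a′ ◅ q , q′))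
  ... | inj₁ (inj₁ (refl , refl)) | inj₁ q               = inj₂ (inj₁ (ε , q))
  ... | inj₁ (inj₁ (refl , refl)) | inj₂ (inj₁ (q , q′)) = inj₂ (inj₁ (ε , q′))
  ... | inj₁ (inj₁ (refl , refl)) | inj₂ (inj₂ (q , q′)) = inj₁ q′
  ... | inj₁ (inj₂ (refl , refl)) | inj₁ q               = inj₂ (inj₂ (ε , q))
  ... | inj₁ (inj₂ (refl , refl)) | inj₂ (inj₁ (q , q′)) = inj₁ q′
  ... | inj₁ (inj₂ (refl , refl)) | inj₂ (inj₂ (q , q′)) = inj₂ (inj₂ (ε , q′))

  -- Unlike `Star`, this keeps the list of vertices visited after the start, in the form in which
  -- `HasCycle` speaks of them.
  data Walk (E : EdgeSet m n) : Vertex m n → List (Vertex m n) → Vertex m n → Set where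
    stop : ∀ {u} → Walk E u [] u
    step : ∀ {u v w vs} → Adj E u v → Walk E v vs w → Walk E u (v ∷ vs) w

  Path : EdgeSet m n → Vertex m n → Vertex m n → Set
  Path E u v = ∃ λ vs → Unique (u ∷ vs) × Walk E u vs v

  open DecMembership _≟ᵥ_ using (_∈?_)

  suffix : ∀ {E u v w vs} → Unique (w ∷ vs) → Walk E w vs v → u ∈ w ∷ vs → Path E u v
  suffix u p (here refl) = _ , u , p
  suffix (_ ∷ u) (step _ p) (there u∈) = suffix u p u∈

  -- If the new start already occurs on the path built so far, the path is cut down to the part from
  -- that occurrence on; otherwise the start is prepended.
  Reach⇒Path : ∀ {E u v} → Reach E u v → Path E u v
  Reach⇒Path ε = [] , [] ∷ [] , stop
  Reach⇒Path {u = u} (_◅_ {j = w} a r) with Reach⇒Path r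
  ... | vs , uniq , p with u ∈? (w ∷ vs)
  ... | yes u∈ = suffix uniq p u∈
  ... | no u∉  = w ∷ vs , All.¬Any⇒All¬ _ u∉ ∷ uniq , step a p

  Walk⇒Linked : ∀ {E F u v vs w} → E ⊆ₑ F → Walk E u vs v → Adj F v w → Linked (Adj F) (u ∷ vs ++ [ w ])
  Walk⇒Linked E⊆F stop        b = b ∷ [-]
  Walk⇒Linked {E} E⊆F (step a stop) b = Adj-mono E⊆F a ∷ Walk⇒Linked {E} E⊆F stop b
  Walk⇒Linked E⊆F (step a p@(step _ _)) b = Adj-mono E⊆F a ∷ Walk⇒Linked E⊆F p b

-- Spanning trees

  -- Acyclicity in the form that survives adding and deleting edges.
  Bridges : EdgeSet m n → Set
  Bridges E = ∀ i j → E ∋ₑ i , j → ¬ Reach (E ⊖ i , j) (inj₁ i) (inj₂ j)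

  -- A route around an edge shortens to a path, which the edge closes to a cycle. A path of a single
  -- step would be the deleted edge itself, so the path is long enough for a cycle.
  acyclic⇒bridges : ∀ {E} → Acyclic E → Bridges E
  acyclic⇒bridges {E} acyclic i j ij∈ r with Reach⇒Path r
  ... | _ ∷ [] , _ , step a stop = ⊖-∌ E i j a
  ... | vs@(_ ∷ _ ∷ _) , uniq , p =
    acyclic (inj₁ i , vs , s≤s (s≤s z≤n) , uniq , Walk⇒Linked (⊖-⊆ E i j) p ij∈)

  -- The rest of a cycle is a route around its first edge `v`, `w`: by uniqueness each further step
  -- has an end different from both `v` and `w`, hence survives the deletion of that edge.
  bridges⇒acyclic : ∀ {E} → Bridges E → Acyclic E
  bridges⇒acyclic {E} bridges
    (v , w ∷ w′ ∷ ws , s≤s (s≤s _) , (v≢w ∷ v≢w′ ∷ v≢) ∷ (w≢w′ ∷ w≢) ∷ _ , a ∷ a′ ∷ as) = edge v w refl refl a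
    where
    avoid : ∀ {i j x y} → Ends i j v w → x ≢ v → x ≢ w → ¬ Ends i j x y
    avoid (inj₁ (refl , refl)) x≢v x≢w (inj₁ (eq , _)) = x≢v eq
    avoid (inj₁ (refl , refl)) x≢v x≢w (inj₂ (eq , _)) = x≢w eq
    avoid (inj₂ (refl , refl)) x≢v x≢w (inj₁ (eq , _)) = x≢w eq
    avoid (inj₂ (refl , refl)) x≢v x≢w (inj₂ (eq , _)) = x≢v eq

    swapEnds : ∀ {i j x y} → Ends i j x y → Ends i j y x
    swapEnds (inj₁ (p , q)) = inj₂ (q , p)
    swapEnds (inj₂ (p , q)) = inj₁ (q , p)

    walk : ∀ {i j} x xs → Ends i j v w → v ≢ x → w ≢ x → All (v ≢_) xs → All (w ≢_) xs →
      Linked (Adj E) (x ∷ xs ++ [ v ]) → Reach (E ⊖ i , j) x v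
    walk x []       e v≢x w≢x _ _ (b ∷ [-]) = Adj-⊖⁺ E _ _ (avoid e (≢-sym v≢x) (≢-sym w≢x)) b ◅ ε
    walk x (y ∷ xs) e v≢x w≢x (v≢y ∷ v≢) (w≢y ∷ w≢) (b ∷ bs) =
      Adj-⊖⁺ E _ _ (avoid e (≢-sym v≢x) (≢-sym w≢x)) b ◅ walk y xs e v≢y w≢y v≢ w≢ bs

    return : ∀ {i j} → Ends i j v w → Reach (E ⊖ i , j) w v
    return e = Adj-⊖⁺ E _ _ (avoid e (≢-sym v≢w′) (≢-sym w≢w′) ∘ swapEnds) a′ ◅ walk w′ ws e v≢w′ w≢w′ v≢ w≢ as

    -- The copies `x` and `y` let the two orientations of the first edge be split while the helpers
    -- above still speak of `v` and `w`.
    edge : ∀ x y → x ≡ v → y ≡ w → Adj E x y → ⊥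
    edge (inj₁ i) (inj₂ j) refl refl ij∈ =
      bridges i j ij∈ (Reach-sym (E ⊖ i , j) (return (inj₁ (refl , refl))))
    edge (inj₂ j) (inj₁ i) refl refl ij∈ = bridges i j ij∈ (return (inj₂ (refl , refl)))

  -- Going around the new edge would mean joining its ends within `E`. Going around an old edge
  -- `k , l` must use the new edge; the two remaining pieces together with `k , l` then join `i` to
  -- `j` within `E`.
  bridges-⊕ : ∀ {E i j} → Bridges E → ¬ Reach E (inj₁ i) (inj₂ j) → Bridges (E ⊕ i , j)
  bridges-⊕ {E} {i} {j} bridges i↛j k l kl∈ r with (i , j) ≟ₑ (k , l)
  ... | yes refl = i↛j (Reach-mono back r)
    where
    back : ((E ⊕ i , j) ⊖ i , j) ⊆ₑ E
    back k l kl∈ with ⊕-∋⁻ E i j k l (⊖-⊆ (E ⊕ i , j) i j k l kl∈)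
    ... | inj₁ refl = ⊥-elim (⊖-∌ (E ⊕ i , j) i j kl∈)
    ... | inj₂ kl∈E = kl∈E
  ... | no ≢ with ⊕-∋⁻ E i j k l kl∈
  ... | inj₁ ≡    = ≢ ≡
  ... | inj₂ kl∈E with Reach-⊕⁻ (E ⊖ k , l) i j (Reach-mono exchange r)
    where
    exchange : ((E ⊕ i , j) ⊖ k , l) ⊆ₑ ((E ⊖ k , l) ⊕ i , j)
    exchange x y xy∈ with ⊕-∋⁻ E i j x y (⊖-⊆ (E ⊕ i , j) k l x y xy∈)
    ... | inj₁ refl = ⊕-∋ (E ⊖ k , l) i j
    ... | inj₂ xy∈E = ⊆-⊕ (E ⊖ k , l) i j x y
      (⊖-∋ E k l x y (λ { refl → ⊖-∌ (E ⊕ i , j) k l xy∈ }) xy∈E)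
  ... | inj₁ q = bridges k l kl∈E q
  ... | inj₂ (inj₁ (q , q′)) = i↛j (Reach-sym E (lift q) ◅◅ kl∈E ◅ Reach-sym E (lift q′))
    where
    lift : ∀ {u v} → Reach (E ⊖ k , l) u v → Reach E u v
    lift = Reach-mono (⊖-⊆ E k l)
  ... | inj₂ (inj₂ (q , q′)) = i↛j (lift q′ ◅◅ _◅_ {j = inj₁ k} kl∈E (lift q))
    where
    lift : ∀ {u v} → Reach (E ⊖ k , l) u v → Reach E u v
    lift = Reach-mono (⊖-⊆ E k l)

-- Forests together with a representative of each component

  record Forest (F : EdgeSet m n) : Set where
    field
      root    : Vertex m n → Vertex m n
      roots   : List (Vertex m n)
      unique  : Unique roots
      root∈   : ∀ v → root v ∈ roots
      fixed   : ∀ {l} → l ∈ roots → root l ≡ l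
      joined  : ∀ v → Reach F v (root v)
      closed  : ∀ {i j} → F ∋ₑ i , j → root (inj₁ i) ≡ root (inj₂ j)
      bridges : Bridges F

    -- With the converse `connect`, the fibres of `root` are exactly the connected components of
    -- `F`.
    closed* : ∀ {u v} → Reach F u v → root u ≡ root v
    closed* ε = refl
    closed* (_◅_ {inj₁ i} {inj₂ j} a p) = trans (closed a) (closed* p)
    closed* (_◅_ {inj₂ j} {inj₁ i} a p) = trans (sym (closed a)) (closed* p)

    connect : ∀ {u v} → root u ≡ root v → Reach F u v
    connect {u} {v} eq = joined u ◅◅ subst (λ w → Reach F w v) (sym eq) (Reach-sym F (joined v))

  open Forest

  redirect : Vertex m n → Vertex m n → Vertex m n → Vertex m n
  redirect a b l with l ≟ᵥ b
  ... | yes _ = a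
  ... | no _  = l

  redirect-≡ : ∀ a b → redirect a b b ≡ a
  redirect-≡ a b with b ≟ᵥ b
  ... | yes _ = refl
  ... | no ≢  = ⊥-elim (≢ refl)

  redirect-≢ : ∀ a b {l} → l ≢ b → redirect a b l ≡ l
  redirect-≢ a b {l} l≢b with l ≟ᵥ b
  ... | yes ≡ = ⊥-elim (l≢b ≡)
  ... | no _  = refl

  module _ {F : EdgeSet m n} (f : Forest F) {i j} (i≁j : root f (inj₁ i) ≢ root f (inj₂ j))
           {rest} (p : roots f ↭ root f (inj₁ i) ∷ root f (inj₂ j) ∷ rest) where

    private
      a b : Vertex m n
      a = root f (inj₁ i)
      b = root f (inj₂ j)

      uniq : Unique (a ∷ b ∷ rest)
      uniq = Unique-resp-↭ p (unique f)

      b∉ : ∀ {l} → l ∈ a ∷ rest → l ≢ b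
      b∉ (here refl) eq = i≁j eq
      b∉ (there l∈) refl with _ ∷ b≢ ∷ _ ← uniq = All.lookup b≢ l∈ refl

      drop : Unique (a ∷ b ∷ rest) → Unique (a ∷ rest)
      drop ((_ ∷ a≢) ∷ _ ∷ u) = a≢ ∷ u

    -- The representative `a` survives for the merged component, and every vertex represented by `b`
    -- is redirected to it. That `a` and `b` differ is what makes the new edge a bridge.
    join : Forest (F ⊕ i , j)
    join .root v = redirect a b (root f v)
    join .roots = a ∷ rest
    join .unique = drop uniq
    join .root∈ v with root f v ≟ᵥ b
    ... | yes _ = here refl
    ... | no ≢ with ∈-resp-↭ p (root∈ f v)
    ... | here ≡         = here ≡
    ... | there (here ≡) = ⊥-elim (≢ ≡)
    ... | there (there l∈) = there l∈
    join .fixed {l} l∈ = trans (cong (redirect a b) (fixed f (∈-resp-↭ (↭-sym p) (weaken l∈)))) (redirect-≢ a b (b∉ l∈))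
      where
      weaken : ∀ {l} → l ∈ a ∷ rest → l ∈ a ∷ b ∷ rest
      weaken (here ≡)   = here ≡
      weaken (there l∈) = there (there l∈)
    join .joined v with root f v ≟ᵥ b
    ... | no _  = Reach-mono (⊆-⊕ F i j) (joined f v)
    ... | yes ≡ = Reach-mono (⊆-⊕ F i j) (connect f {v} {inj₂ j} ≡) ◅◅
      _◅_ {j = inj₁ i} (⊕-∋ F i j) (Reach-mono (⊆-⊕ F i j) (joined f (inj₁ i)))
    join .closed {k} {l} kl∈ with ⊕-∋⁻ F i j k l kl∈
    ... | inj₁ refl = trans (redirect-≢ a b i≁j) (sym (redirect-≡ a b))
    ... | inj₂ kl∈F = cong (redirect a b) (closed f kl∈F)
    join .bridges = bridges-⊕ (bridges f) (i≁j ∘ closed* f)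

  noEdges : EdgeSet m n
  noEdges = replicate m (replicate n false)

  noEdges-∌ : ∀ i j → ¬ noEdges ∋ₑ i , j
  noEdges-∌ i j ij∈ with () ← trans (sym (trans (cong (λ r → lookup r j) (Vec.lookup-replicate i _)) (Vec.lookup-replicate j false))) ij∈

  vertices : List (Vertex m n)
  vertices = map inj₁ (allFin m) ++ map inj₂ (allFin n)

  vertices-unique : Unique vertices
  vertices-unique = Unique.++⁺ (Unique.map⁺ Sum.inj₁-injective (Unique.allFin⁺ m))
    (Unique.map⁺ Sum.inj₂-injective (Unique.allFin⁺ n)) λ (p , q) → case p q
    where
    case : ∀ {v} → v ∈ map inj₁ (allFin m) → v ∈ map inj₂ (allFin n) → ⊥
    case p q with _ , _ , refl ← ∈-map⁻ inj₁ p with () ← proj₂ (proj₂ (∈-map⁻ inj₂ q))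

  ∈-vertices : ∀ v → v ∈ vertices
  ∈-vertices (inj₁ i) = ∈-++⁺ˡ (∈-map⁺ inj₁ (∈-allFin i))
  ∈-vertices (inj₂ j) = ∈-++⁺ʳ (map inj₁ (allFin m)) (∈-map⁺ inj₂ (∈-allFin j))

  discrete : Forest noEdges
  discrete .root = id
  discrete .roots = vertices
  discrete .unique = vertices-unique
  discrete .root∈ = ∈-vertices
  discrete .fixed _ = refl
  discrete .joined _ = ε
  discrete .closed ij∈ = ⊥-elim (noEdges-∌ _ _ ij∈)
  discrete .bridges i j ij∈ = ⊥-elim (noEdges-∌ i j ij∈)

-- Enumeration of all edge sets

allVecs : {A : Set} → List A → (k : ℕ) → List (Vec A k)
allVecs xs zero    = [ [] ]
allVecs xs (suc k) = cartesianProductWith _∷_ xs (allVecs xs k)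

allVecs-unique : {A : Set} {xs : List A} → Unique xs → ∀ k → Unique (allVecs xs k)
allVecs-unique u zero    = [] ∷ []
allVecs-unique u (suc k) = Unique.cartesianProductWith⁺ _∷_ Vec.∷-injective u (allVecs-unique u k)

∈-allVecs : {A : Set} {xs : List A} → (∀ x → x ∈ xs) → ∀ {k} (v : Vec A k) → v ∈ allVecs xs k
∈-allVecs x∈ []      = here refl
∈-allVecs x∈ (x ∷ v) = ∈-cartesianProductWith⁺ _∷_ (x∈ x) (∈-allVecs x∈ v)

bools : List Bool
bools = true ∷ false ∷ []

bools-unique : Unique bools
bools-unique = ((λ ()) ∷ []) ∷ [] ∷ []

∈-bools : ∀ b → b ∈ bools
∈-bools true  = here refl
∈-bools false = there (here refl)

lookup-ext : {A : Set} {k : ℕ} (u v : Vec A k) → (∀ i → lookup u i ≡ lookup v i) → u ≡ v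
lookup-ext []      []      h = refl
lookup-ext (x ∷ u) (y ∷ v) h = cong₂ _∷_ (h Fin.zero) (lookup-ext u v (h ∘ Fin.suc))

module _ {m n : ℕ} where

  open Forest

  allEdgeSets : List (EdgeSet m n)
  allEdgeSets = allVecs (allVecs bools n) m

  allEdgeSets-unique : Unique allEdgeSets
  allEdgeSets-unique = allVecs-unique (allVecs-unique bools-unique n) m

  ∈-allEdgeSets : ∀ E → E ∈ allEdgeSets
  ∈-allEdgeSets = ∈-allVecs (∈-allVecs ∈-bools)

  count-filter : {P : EdgeSet m n → Set} (P? : ∀ T → Dec (P T)) → CountIs P (length (filter P? allEdgeSets))
  count-filter P? = filter P? allEdgeSets , Unique.filter⁺ P? allEdgeSets-unique ,
    (λ T → mk⇔ (proj₂ ∘ ∈-filter⁻ P? {xs = allEdgeSets}) (∈-filter⁺ P? (∈-allEdgeSets T))) , refl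

  _≟ˢ_ : DecidableEquality (EdgeSet m n)
  _≟ˢ_ = Vec.≡-dec (Vec.≡-dec Bool._≟_)

  ⊆-antisym : {E F : EdgeSet m n} → E ⊆ₑ F → F ⊆ₑ E → E ≡ F
  ⊆-antisym {E} {F} E⊆F F⊆E = lookup-ext E F λ i → lookup-ext _ _ λ j → same (E⊆F i j) (F⊆E i j)
    where
    same : ∀ {a b} → (a ≡ true → b ≡ true) → (b ≡ true → a ≡ true) → a ≡ b
    same {true}          f g = sym (f refl)
    same {false} {true}  f g = g refl
    same {false} {false} f g = refl

  edges : List (Fin m × Fin n)
  edges = cartesianProduct (allFin m) (allFin n)

  edges-unique : Unique edges
  edges-unique = Unique.cartesianProduct⁺ (Unique.allFin⁺ m) (Unique.allFin⁺ n)

  ∈-edges : ∀ e → e ∈ edges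
  ∈-edges (i , j) = ∈-cartesianProduct⁺ (∈-allFin i) (∈-allFin j)

  -- Spanning trees and the forests inside them

  -- Otherwise `F` would already connect the ends of the edge, giving a route in `T` that avoids it.
  tree-edge-crosses : ∀ {F T : EdgeSet m n} (f : Forest F) → F ⊆ₑ T → Bridges T → ∀ {i j} → T ∋ₑ i , j → ¬ F ∋ₑ i , j →
    root f (inj₁ i) ≢ root f (inj₂ j)
  tree-edge-crosses {F} {T} f F⊆T br {i} {j} ij∈T ij∉F eq = br i j ij∈T (Reach-mono avoids (connect f eq))
    where
    avoids : F ⊆ₑ (T ⊖ i , j)
    avoids k l kl∈ = ⊖-∋ T i j k l (λ { refl → ij∉F kl∈ }) (F⊆T k l kl∈)

  one-root : ∀ {F : EdgeSet m n} (f : Forest F) → length (roots f) ≡ 1 → ∀ u v → root f u ≡ root f v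
  one-root f eq u v = go (roots f) eq (root∈ f u) (root∈ f v)
    where
    go : ∀ {a b} ls → length ls ≡ 1 → a ∈ ls → b ∈ ls → a ≡ b
    go (_ ∷ []) _ (here refl) (here refl) = refl

  -- The vertex `v₀` shows that there is a representative at all; two different ones would be fixed
  -- by `root` and yet, being connected, have the same root.
  roots-of-connected : ∀ {F : EdgeSet m n} (f : Forest F) → Vertex m n → Connected F → length (roots f) ≡ 1
  roots-of-connected {F} f v₀ conn = go (roots f) (unique f) (root∈ f v₀) (fixed f)
    where
    go : ∀ ls → Unique ls → root f v₀ ∈ ls → (∀ {l} → l ∈ ls → root f l ≡ l) → length ls ≡ 1
    go (_ ∷ [])     _ _ _ = refl
    go (k ∷ l ∷ ls) ((k≢l ∷ _) ∷ _) _ fx = ⊥-elim (k≢l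
      (trans (sym (fx (here refl))) (trans (closed* f (conn k l)) (fx (there (here refl))))))

  edge-or-⊆ : (F T : EdgeSet m n) → (∃₂ λ i j → T ∋ₑ i , j × ¬ F ∋ₑ i , j) ⊎ T ⊆ₑ F
  edge-or-⊆ F T with Fin.any? (λ i → Fin.any? (λ j → (T ∋? i , j) ×-dec ¬? (F ∋? i , j)))
  ... | yes e = inj₁ e
  ... | no ¬e = inj₂ λ i j ij∈T → decidable-stable (F ∋? i , j) λ ij∉F → ¬e (i , j , ij∈T , ij∉F)

  missing : (T F : EdgeSet m n) → ℚ
  missing T F = ∑ edges λ (i , j) → 𝟙 (T ∋? i , j) * 𝟙 (¬? (F ∋? i , j))

  missing-⊕ : ∀ {T F : EdgeSet m n} {i j} → T ∋ₑ i , j → ¬ F ∋ₑ i , j → missing T F ≡ 1ℚ + missing T (F ⊕ i , j)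
  missing-⊕ {T} {F} {i} {j} ij∈T ij∉F = begin
      missing T F
    ≡⟨ ∑-cong edges (λ {e} _ → pointwise e) ⟩
      ∑ edges (λ e → 𝟙 ((i , j) ≟ₑ e) * 1ℚ + 𝟙 (T ∋? proj₁ e , proj₂ e) * 𝟙 (¬? ((F ⊕ i , j) ∋? proj₁ e , proj₂ e)))
    ≡⟨ ∑-+ edges _ _ ⟩
      ∑ edges (λ e → 𝟙 ((i , j) ≟ₑ e) * 1ℚ) + missing T (F ⊕ i , j)
    ≡⟨ cong (_+ missing T (F ⊕ i , j)) (∑-δ _≟ₑ_ (λ _ → 1ℚ) edges-unique (∈-edges (i , j))) ⟩
      1ℚ + missing T (F ⊕ i , j) ∎
    where
    open ≡-Reasoning
    pointwise : ∀ e → 𝟙 (T ∋? proj₁ e , proj₂ e) * 𝟙 (¬? (F ∋? proj₁ e , proj₂ e)) ≡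
      𝟙 ((i , j) ≟ₑ e) * 1ℚ + 𝟙 (T ∋? proj₁ e , proj₂ e) * 𝟙 (¬? ((F ⊕ i , j) ∋? proj₁ e , proj₂ e))
    pointwise (k , l) with (i , j) ≟ₑ (k , l)
    ... | yes refl = begin
        𝟙 (T ∋? i , j) * 𝟙 (¬? (F ∋? i , j))
      ≡⟨ cong₂ _*_ (𝟙-yes (T ∋? i , j) ij∈T) (𝟙-yes (¬? (F ∋? i , j)) ij∉F) ⟩
        1ℚ
      ≡⟨ cong₂ (λ x y → 1ℚ * 1ℚ + x * y) (sym (𝟙-yes (T ∋? i , j) ij∈T))
           (sym (𝟙-no (¬? ((F ⊕ i , j) ∋? i , j)) (_$ ⊕-∋ F i j))) ⟩
        1ℚ * 1ℚ + 𝟙 (T ∋? i , j) * 𝟙 (¬? ((F ⊕ i , j) ∋? i , j)) ∎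
    ... | no ≢ = trans
      (cong (𝟙 (T ∋? k , l) *_) (𝟙-⇔ (¬? (F ∋? k , l)) (¬? ((F ⊕ i , j) ∋? k , l))
        (λ kl∉ kl∈ → Sum.[ ≢ , kl∉ ] (⊕-∋⁻ F i j k l kl∈)) (λ kl∉ kl∈ → kl∉ (⊆-⊕ F i j k l kl∈))))
      (sym (ℚ.+-identityˡ _))

  -- An edge of `T` outside `F` joins two components, so adding it to `F` lowers both sides by one.
  -- When no such edge is left, `F` is `T`, which is connected and so has a single representative.
  missing-edges : ∀ c {T F : EdgeSet m n} (f : Forest F) → length (roots f) ≡ c → Vertex m n →
    F ⊆ₑ T → Connected T → Bridges T → missing T F ≡ ∑ (roots f) (λ _ → 1ℚ) - 1ℚ
  missing-edges c {T} {F} f len v₀ F⊆T conn br with edge-or-⊆ F T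
  ... | inj₂ T⊆F with refl ← ⊆-antisym {F} {T} F⊆T T⊆F = trans
      (∑-cong edges (λ {e} _ → zero-term e))
      (trans (∑-0 edges) (sym (trans (cong (_- 1ℚ) (trans (∑-1 (roots f)) (cong ℕ→ℚ (roots-of-connected f v₀ conn)))) refl)))
    where
    zero-term : ∀ e → 𝟙 (T ∋? proj₁ e , proj₂ e) * 𝟙 (¬? (T ∋? proj₁ e , proj₂ e)) ≡ 0ℚ
    zero-term (i , j) with T ∋? i , j
    ... | yes _ = refl
    ... | no _  = refl
  ... | inj₁ (i , j , ij∈T , ij∉F)
    with rest , p ← extract₂ (root∈ f (inj₁ i)) (root∈ f (inj₂ j)) (tree-edge-crosses f F⊆T br ij∈T ij∉F)
    -- Splitting the number of components makes the recursion structural; `eq` excludes zero, and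
    -- the joined forest has exactly one representative fewer.
    with c | trans (sym len) (↭-length p)
  ... | suc c | eq = begin
        missing T F
      ≡⟨ missing-⊕ {T} {F} ij∈T ij∉F ⟩
        1ℚ + missing T (F ⊕ i , j)
      ≡⟨ cong (_+_ 1ℚ) (missing-edges c (join f (tree-edge-crosses f F⊆T br ij∈T ij∉F) p) (sym (ℕ.suc-injective eq)) v₀ (⊕-⊆ {E = F} {T} F⊆T ij∈T) conn br) ⟩
        1ℚ + (1ℚ + ∑ rest (λ _ → 1ℚ) - 1ℚ)
      ≡⟨ solve 1 (λ s → con 1ℚ :+ (con 1ℚ :+ s :- con 1ℚ) := con 1ℚ :+ (con 1ℚ :+ s) :- con 1ℚ) refl (∑ rest (λ _ → 1ℚ)) ⟩
        1ℚ + (1ℚ + ∑ rest (λ _ → 1ℚ)) - 1ℚ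
      ≡⟨ cong (_- 1ℚ) (sym (∑-↭ _ p)) ⟩
        ∑ (roots f) (λ _ → 1ℚ) - 1ℚ ∎
    where open ≡-Reasoning

  -- Greedy growth: as long as some edge of `T` joins two components it is added, and each addition
  -- uses up one representative.
  spanningForest : ∀ T c {F : EdgeSet m n} (f : Forest F) → length (roots f) ≡ c → F ⊆ₑ T →
    ∃ λ F′ → Σ (Forest F′) λ f′ → F′ ⊆ₑ T × (∀ i j → T ∋ₑ i , j → root f′ (inj₁ i) ≡ root f′ (inj₂ j))
  spanningForest T c {F} f len F⊆T
    with Fin.any? (λ i → Fin.any? (λ j → (T ∋? i , j) ×-dec ¬? (root f (inj₁ i) ≟ᵥ root f (inj₂ j))))
  ... | no ¬e = F , f , F⊆T , λ i j ij∈ → decidable-stable (_ ≟ᵥ _) λ i≁j → ¬e (i , j , ij∈ , i≁j)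
  ... | yes (i , j , ij∈ , i≁j)
    with rest , p ← extract₂ (root∈ f (inj₁ i)) (root∈ f (inj₂ j)) i≁j
    with c | trans (sym len) (↭-length p)
  ... | suc c | eq = spanningForest T c (join f i≁j p) (sym (ℕ.suc-injective eq)) (⊕-⊆ {E = F} {T} F⊆T ij∈)

  -- Compares `T` with a maximal forest `F` inside it. An edge of `T` outside `F` has both ends in
  -- one component and therefore lies on a cycle. If there is none, `T` is this forest, and it is
  -- connected exactly when it has one representative.
  spanningTree? : Vertex m n → (T : EdgeSet m n) → Dec (IsSpanningTree T)
  spanningTree? v₀ T with spanningForest T _ discrete refl (λ i j ij∈ → ⊥-elim (noEdges-∌ i j ij∈))
  ... | F , f , F⊆T , maximal with T ⊆? F | length (roots f) ℕ.≟ 1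
  ... | no T⊈F  | _ = no λ (_ , acyclic) → T⊈F λ i j ij∈ → decidable-stable (F ∋? i , j) λ ij∉F →
    tree-edge-crosses f F⊆T (acyclic⇒bridges acyclic) ij∈ ij∉F (maximal i j ij∈)
  ... | yes T⊆F | d with refl ← ⊆-antisym {F} {T} F⊆T T⊆F with d
  ... | yes one = yes ((λ u v → connect f (one-root f one u v)) , bridges⇒acyclic (bridges f))
  ... | no ¬one = no λ (conn , _) → ¬one (roots-of-connected f v₀ conn)

  -- Component sizes on the two sides

  left right : {F : EdgeSet m n} → Forest F → Vertex m n → ℚ
  left  f l = ∑ (allFin m) λ i → 𝟙 (root f (inj₁ i) ≟ᵥ l)
  right f l = ∑ (allFin n) λ j → 𝟙 (root f (inj₂ j) ≟ᵥ l)

  ∑-allFin-1 : ∀ k → ∑ (allFin k) (λ _ → 1ℚ) ≡ ℕ→ℚ k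
  ∑-allFin-1 k = trans (∑-1 (allFin k)) (cong ℕ→ℚ (length-tabulate {n = k} id))

  ∑-left : ∀ {F} (f : Forest F) → ∑ (roots f) (left f) ≡ ℕ→ℚ m
  ∑-left f = trans (∑-cong (roots f) (λ {l} _ → sym (ℚ.*-identityʳ (left f l))))
    (trans (sym (∑-fibre _≟ᵥ_ (allFin m) (roots f) (root f ∘ inj₁) (λ _ → 1ℚ) (unique f) (root∈ f ∘ inj₁))) (∑-allFin-1 m))

  ∑-right : ∀ {F} (f : Forest F) → ∑ (roots f) (right f) ≡ ℕ→ℚ n
  ∑-right f = trans (∑-cong (roots f) (λ {l} _ → sym (ℚ.*-identityʳ (right f l))))
    (trans (sym (∑-fibre _≟ᵥ_ (allFin n) (roots f) (root f ∘ inj₂) (λ _ → 1ℚ) (unique f) (root∈ f ∘ inj₂))) (∑-allFin-1 n))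

  redirect-indicator-kept : ∀ {a b : Vertex m n} r → a ≢ b → 𝟙 (redirect a b r ≟ᵥ a) ≡ 𝟙 (r ≟ᵥ a) + 𝟙 (r ≟ᵥ b)
  redirect-indicator-kept {a} {b} r a≢b with r ≟ᵥ b
  ... | yes refl = trans (𝟙-yes (a ≟ᵥ a) refl) (cong (_+ 1ℚ) (sym (𝟙-no (b ≟ᵥ a) (≢-sym a≢b))))
  ... | no _     = sym (ℚ.+-identityʳ _)

  redirect-indicator-other : ∀ {a b l : Vertex m n} r → a ≢ l → b ≢ l → 𝟙 (redirect a b r ≟ᵥ l) ≡ 𝟙 (r ≟ᵥ l)
  redirect-indicator-other {a} {b} {l} r a≢l b≢l with r ≟ᵥ b
  ... | yes refl = trans (𝟙-no (a ≟ᵥ l) a≢l) (sym (𝟙-no (b ≟ᵥ l) b≢l))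
  ... | no _     = refl

-- Counting spanning trees that contain a forest

module ForestCount {m n : ℕ} (v₀ : Vertex m n) {M N : ℚ} (m≡M : ℕ→ℚ m ≡ M) (n≡N : ℕ→ℚ n ≡ N)
                   (M≢0 : M ≢ 0ℚ) (N≢0 : N ≢ 0ℚ) where

  open Forest
  open ForestFormula {Vertex m n} M N

  private
    Ts : List (EdgeSet m n)
    Ts = allEdgeSets

    es : List (Fin m × Fin n)
    es = edges

  extends? : (F T : EdgeSet m n) → Dec (IsSpanningTree T × F ⊆ₑ T)
  extends? F T = spanningTree? v₀ T ×-dec (F ⊆? T)

  τ : EdgeSet m n → ℚ
  τ F = ∑ Ts λ T → 𝟙 (extends? F T)

  -- The weight is the image of a natural number, and in ℕ a vanishing sum has vanishing terms. But
  -- the representative belongs to its own component, so one of the two sizes is positive.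
  weight-root : ∀ {F} (f : Forest F) → ∀ {l} → l ∈ roots f → weight (left f) (right f) l ≢ 0ℚ
  weight-root f {l} l∈ eq = bad l (fixed f l∈)
    where
    i∼? = λ i → root f (inj₁ i) ≟ᵥ l
    j∼? = λ j → root f (inj₂ j) ≟ᵥ l
    a b : ℕ
    a = length (filter i∼? (allFin m))
    b = length (filter j∼? (allFin n))
    eq′ : ℕ→ℚ (a ℕ.* n ℕ.+ b ℕ.* m) ≡ 0ℚ
    eq′ = trans (ℕ→ℚ-+ (a ℕ.* n) (b ℕ.* m)) (trans (cong₂ _+_
      (trans (ℕ→ℚ-* a n) (cong₂ _*_ (length-filter i∼? (allFin m)) n≡N))
      (trans (ℕ→ℚ-* b m) (cong₂ _*_ (length-filter j∼? (allFin n)) m≡M))) eq)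
    zero-sum : a ℕ.* n ℕ.+ b ℕ.* m ≡ 0
    zero-sum = ℕ→ℚ≡0⇒≡0 (a ℕ.* n ℕ.+ b ℕ.* m) eq′
    nonempty : ∀ {A : Set} {x : A} {xs} → x ∈ xs → length xs ≢ 0
    nonempty (here _)  ()
    nonempty (there _) ()
    factor-zero : ∀ x {y Y} → ℕ→ℚ y ≡ Y → Y ≢ 0ℚ → x ℕ.* y ≡ 0 → x ≡ 0
    factor-zero x y≡Y Y≢0 xy≡0 with ℕ.m*n≡0⇒m≡0∨n≡0 x xy≡0
    ... | inj₁ x≡0  = x≡0
    ... | inj₂ refl = ⊥-elim (Y≢0 (sym y≡Y))
    bad : ∀ k → root f k ≢ l
    bad (inj₁ i) e = nonempty (∈-filter⁺ i∼? (∈-allFin i) e)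
      (factor-zero a n≡N N≢0 (ℕ.m+n≡0⇒m≡0 (a ℕ.* n) zero-sum))
    bad (inj₂ j) e = nonempty (∈-filter⁺ j∼? (∈-allFin j) e)
      (factor-zero b m≡M M≢0 (ℕ.m+n≡0⇒n≡0 (a ℕ.* n) zero-sum))

  -- Both sides count pairs of a tree extending `F` and one of its edges outside `F`. Edges with
  -- both ends in one component are still included on the right; `τ-⊕-inside` shows that they
  -- contribute nothing.
  double-count : ∀ {F} (f : Forest F) → (∑ (roots f) (λ _ → 1ℚ) - 1ℚ) * τ F ≡
    ∑ es λ (i , j) → 𝟙 (¬? (F ∋? i , j)) * τ (F ⊕ i , j)
  double-count {F} f = begin
      c * τ F
    ≡⟨ sym (∑-*ˡ Ts c _) ⟩
      ∑ Ts (λ T → c * 𝟙 (extends? F T))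
    ≡⟨ ∑-cong Ts (λ {T} _ → trans (ℚ.*-comm c _) (𝟙-cong (extends? F T) λ ((conn , acyclic) , F⊆T) →
         sym (missing-edges _ f refl v₀ F⊆T conn (acyclic⇒bridges acyclic)))) ⟩
      ∑ Ts (λ T → 𝟙 (extends? F T) * missing T F)
    ≡⟨ ∑-cong Ts (λ {T} _ → sym (∑-*ˡ es (𝟙 (extends? F T)) _)) ⟩
      ∑ Ts (λ T → ∑ es λ (i , j) → 𝟙 (extends? F T) * (𝟙 (T ∋? i , j) * 𝟙 (¬? (F ∋? i , j))))
    ≡⟨ ∑-swap Ts es _ ⟩
      ∑ es (λ (i , j) → ∑ Ts λ T → 𝟙 (extends? F T) * (𝟙 (T ∋? i , j) * 𝟙 (¬? (F ∋? i , j))))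
    ≡⟨ ∑-cong es (λ {(i , j)} _ → trans (∑-cong Ts (λ {T} _ → pointwise i j T))
         (∑-*ˡ Ts (𝟙 (¬? (F ∋? i , j))) _)) ⟩
      ∑ es (λ (i , j) → 𝟙 (¬? (F ∋? i , j)) * τ (F ⊕ i , j)) ∎
    where
    open ≡-Reasoning
    c : ℚ
    c = ∑ (roots f) (λ _ → 1ℚ) - 1ℚ
    pointwise : ∀ i j T → 𝟙 (extends? F T) * (𝟙 (T ∋? i , j) * 𝟙 (¬? (F ∋? i , j))) ≡
      𝟙 (¬? (F ∋? i , j)) * 𝟙 (extends? (F ⊕ i , j) T)
    pointwise i j T = begin
        𝟙 (extends? F T) * (𝟙 (T ∋? i , j) * 𝟙 (¬? (F ∋? i , j)))
      ≡⟨ solve 3 (λ x y z → x :* (y :* z) := z :* (x :* y)) refl (𝟙 (extends? F T)) (𝟙 (T ∋? i , j)) (𝟙 (¬? (F ∋? i , j))) ⟩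
        𝟙 (¬? (F ∋? i , j)) * (𝟙 (extends? F T) * 𝟙 (T ∋? i , j))
      ≡⟨ cong (𝟙 (¬? (F ∋? i , j)) *_) (trans (sym (𝟙-× (extends? F T) (T ∋? i , j)))
           (𝟙-⇔ (extends? F T ×-dec (T ∋? i , j)) (extends? (F ⊕ i , j) T)
             (λ ((tree , F⊆T) , ij∈) → tree , ⊕-⊆ {E = F} {T} F⊆T ij∈)
             (λ (tree , F′⊆T) → (tree , λ k l kl∈ → F′⊆T k l (⊆-⊕ F i j k l kl∈)) , F′⊆T i j (⊕-∋ F i j)))) ⟩
        𝟙 (¬? (F ∋? i , j)) * 𝟙 (extends? (F ⊕ i , j) T) ∎

  τ-⊕-inside : ∀ {F} (f : Forest F) {i j} → ¬ F ∋ₑ i , j → root f (inj₁ i) ≡ root f (inj₂ j) → τ (F ⊕ i , j) ≡ 0ℚ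
  τ-⊕-inside {F} f {i} {j} ij∉F i∼j = trans (∑-cong Ts (λ {T} _ → 𝟙-no (extends? (F ⊕ i , j) T)
    λ ((_ , acyclic) , F′⊆T) → tree-edge-crosses f (λ k l kl∈ → F′⊆T k l (⊆-⊕ F i j k l kl∈))
      (acyclic⇒bridges acyclic) (F′⊆T i j (⊕-∋ F i j)) ij∉F i∼j)) (∑-0 Ts)

  -- The only tree extending `F` is `F` itself, since a further edge would have to join two
  -- different components.
  τ-tree : ∀ {F} (f : Forest F) → length (roots f) ≡ 1 → τ F ≡ 1ℚ
  τ-tree {F} f one = begin
      τ F
    ≡⟨ ∑-cong Ts (λ {T} _ → trans (𝟙-⇔ (extends? F T) (F ≟ˢ T) to from) (sym (ℚ.*-identityʳ _))) ⟩
      ∑ Ts (λ T → 𝟙 (F ≟ˢ T) * 1ℚ)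
    ≡⟨ ∑-δ _≟ˢ_ (λ _ → 1ℚ) allEdgeSets-unique (∈-allEdgeSets F) ⟩
      1ℚ ∎
    where
    open ≡-Reasoning
    to : ∀ {T} → IsSpanningTree T × F ⊆ₑ T → F ≡ T
    to {T} ((_ , acyclic) , F⊆T) with edge-or-⊆ F T
    ... | inj₂ T⊆F = ⊆-antisym F⊆T T⊆F
    ... | inj₁ (i , j , ij∈T , ij∉F) = ⊥-elim
      (tree-edge-crosses f F⊆T (acyclic⇒bridges acyclic) ij∈T ij∉F (one-root f one (inj₁ i) (inj₂ j)))
    from : ∀ {T} → F ≡ T → IsSpanningTree T × F ⊆ₑ T
    from refl = ((λ u v → connect f (one-root f one u v)) , bridges⇒acyclic (bridges f)) , λ _ _ → id

  componentValue : ∀ {F} → Forest F → ℚ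
  componentValue f = value (left f) (right f) (roots f)

  value-join : ∀ {F} (f : Forest F) {i j} (i≁j : root f (inj₁ i) ≢ root f (inj₂ j)) {rest}
    (π : roots f ↭ root f (inj₁ i) ∷ root f (inj₂ j) ∷ rest) →
    componentValue (join f i≁j π) ≡ ∏ (roots f) (weight (left f) (right f)) *
      mergeFactor (left f) (right f) (defect (left f) (right f) (roots f)) (root f (inj₁ i)) (root f (inj₂ j))
  value-join f {i} {j} i≁j {rest} π = value-merge (left f) (right f) (left (join f i≁j π)) (right (join f i≁j π)) π
    (weight-root f (root∈ f (inj₁ i))) (weight-root f (root∈ f (inj₂ j))) (weight-root (join f i≁j π) (here refl))
    (trans (∑-cong (allFin m) (λ {k} _ → redirect-indicator-kept (root f (inj₁ k)) i≁j)) (∑-+ (allFin m) _ _))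
    (trans (∑-cong (allFin n) (λ {k} _ → redirect-indicator-kept (root f (inj₂ k)) i≁j)) (∑-+ (allFin n) _ _))
    (λ l∈ → ∑-cong (allFin m) (λ {k} _ → redirect-indicator-other (root f (inj₁ k)) (i≢ l∈) (j≢ l∈)))
    (λ l∈ → ∑-cong (allFin n) (λ {k} _ → redirect-indicator-other (root f (inj₂ k)) (i≢ l∈) (j≢ l∈)))
    where
    i≢ : ∀ {l} → l ∈ rest → root f (inj₁ i) ≢ l
    i≢ l∈ with (_ ∷ i∉) ∷ _ ← Unique-resp-↭ π (unique f) = All.lookup i∉ l∈
    j≢ : ∀ {l} → l ∈ rest → root f (inj₂ j) ≢ l
    j≢ l∈ with _ ∷ j∉ ∷ _ ← Unique-resp-↭ π (unique f) = All.lookup j∉ l∈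

  -- The recursion determines `τ F` only after division by the number of components minus one, so a
  -- single component is the base case.
  forest-count : ∀ c {F} (f : Forest F) → length (roots f) ≡ suc c → M * N * τ F ≡ componentValue f
  forest-count zero {F} f len = trans (trans (cong (M * N *_) (τ-tree f len)) (ℚ.*-identityʳ _))
    (single (roots f) len (trans (∑-left f) m≡M) (trans (∑-right f) n≡N) (weight-root f))
    where
    open ≡-Reasoning
    single : ∀ ls → length ls ≡ 1 → ∑ ls (left f) ≡ M → ∑ ls (right f) ≡ N →
      (∀ {l} → l ∈ ls → weight (left f) (right f) l ≢ 0ℚ) → M * N ≡ value (left f) (right f) ls
    -- The only component has sizes `M` and `N` and weight 2 M N, so its value is 2 M N - M N.
    single (l ∷ []) _ ∑a ∑b w≢0 = begin
        M * N
      ≡⟨ solve 2 (λ M N → M :* N := (M :* N :+ N :* M) :- M :* N :* con 1ℚ) refl M N ⟩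
        (M * N + N * M) - M * N * 1ℚ
      ≡⟨ cong₂ (λ a b → (a * N + b * M) - a * b * 1ℚ) (trans (sym ∑a) (ℚ.+-identityʳ a)) (trans (sym ∑b) (ℚ.+-identityʳ b)) ⟩
        w - a * b * 1ℚ
      ≡⟨ cong (λ e → w - a * b * e) (sym (inv-* (w≢0 (here refl)))) ⟩
        w - a * b * (w * inv w)
      ≡⟨ solve 4 (λ w a b r → w :- a :* b :* (w :* r) := (w :* con 1ℚ) :* (con 1ℚ :- (a :* b :* r :+ con 0ℚ))) refl w a b (inv w) ⟩
        (w * 1ℚ) * (1ℚ - (a * b * inv w + 0ℚ)) ∎
      where
      a b w : ℚ
      a = left f l
      b = right f l
      w = weight (left f) (right f) l
  forest-count (suc c) {F} f len = *-cancelˡ _ _ c≢0 (begin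
      C * (M * N * τ F)
    ≡⟨ solve 3 (λ c k t → c :* (k :* t) := k :* (c :* t)) refl C (M * N) (τ F) ⟩
      M * N * (C * τ F)
    ≡⟨ cong (M * N *_) (double-count f) ⟩
      M * N * ∑ es (λ (i , j) → 𝟙 (¬? (F ∋? i , j)) * τ (F ⊕ i , j))
    ≡⟨ sym (∑-*ˡ es (M * N) _) ⟩
      ∑ es (λ (i , j) → M * N * (𝟙 (¬? (F ∋? i , j)) * τ (F ⊕ i , j)))
    ≡⟨ ∑-cong es (λ {(i , j)} _ → edge-term i j) ⟩
      ∑ es (λ (i , j) → H (root f (inj₁ i)) (root f (inj₂ j)))
    ≡⟨ ∑-cartesian (allFin m) (allFin n) _ ⟩
      ∑ (allFin m) (λ i → ∑ (allFin n) λ j → H (root f (inj₁ i)) (root f (inj₂ j)))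
    -- The summand depends on an edge only through the components of its ends, so right ends and
    -- then left ends are grouped by component.
    ≡⟨ ∑-cong (allFin m) (λ {i} _ → ∑-fibre _≟ᵥ_ (allFin n) ls (root f ∘ inj₂) (H (root f (inj₁ i))) (unique f) (root∈ f ∘ inj₂)) ⟩
      ∑ (allFin m) (λ i → ∑ ls λ l → b l * H (root f (inj₁ i)) l)
    ≡⟨ ∑-fibre _≟ᵥ_ (allFin m) ls (root f ∘ inj₁) (λ k → ∑ ls λ l → b l * H k l) (unique f) (root∈ f ∘ inj₁) ⟩
      ∑ ls (λ k → a k * ∑ ls (λ l → b l * H k l))
    ≡⟨ ∑-cong ls (λ {k} _ → trans (sym (∑-*ˡ ls (a k) _)) (trans (∑-cong ls (λ {l} _ →
         solve 5 (λ a b d P μ → a :* (b :* (d :* (P :* μ))) := P :* (d :* (a :* b :* μ))) refl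
           (a k) (b l) (𝟙 (¬? (k ≟ᵥ l))) P (μ k l))) (∑-*ˡ ls P _))) ⟩
      ∑ ls (λ k → P * ∑ ls (λ l → 𝟙 (¬? (k ≟ᵥ l)) * (a k * b l * μ k l)))
    ≡⟨ ∑-*ˡ ls P _ ⟩
      P * ∑ ls (λ k → ∑ ls (λ l → 𝟙 (¬? (k ≟ᵥ l)) * (a k * b l * μ k l)))
    ≡⟨ cong (P *_) (∑-mergeFactor _≟ᵥ_ a b (unique f) (weight-root f) M≢0 N≢0 (trans (∑-left f) m≡M) (trans (∑-right f) n≡N)) ⟩
      P * (C * defect a b ls)
    ≡⟨ solve 3 (λ P c t → P :* (c :* t) := c :* (P :* t)) refl P C (defect a b ls) ⟩
      C * componentValue f ∎)
    where
    open ≡-Reasoning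
    ls : List (Vertex m n)
    ls = roots f
    a b : Vertex m n → ℚ
    a = left f
    b = right f
    C P : ℚ
    C = ∑ ls (λ _ → 1ℚ) - 1ℚ
    P = ∏ ls (weight a b)
    μ H : Vertex m n → Vertex m n → ℚ
    μ = mergeFactor a b (defect a b ls)
    H k l = 𝟙 (¬? (k ≟ᵥ l)) * (P * μ k l)

    c≢0 : C ≢ 0ℚ
    c≢0 eq = ℕ→ℚ-suc≢0 c (begin
        ℕ→ℚ (suc c)
      ≡⟨ solve 1 (λ x → x := con 1ℚ :+ x :- con 1ℚ) refl (ℕ→ℚ (suc c)) ⟩
        1ℚ + ℕ→ℚ (suc c) - 1ℚ
      ≡⟨ cong (_- 1ℚ) (sym (trans (∑-1 ls) (trans (cong ℕ→ℚ len) (ℕ→ℚ-suc (suc c))))) ⟩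
        C
      ≡⟨ eq ⟩
        0ℚ ∎)

    edge-term : ∀ i j → M * N * (𝟙 (¬? (F ∋? i , j)) * τ (F ⊕ i , j)) ≡ H (root f (inj₁ i)) (root f (inj₂ j))
    edge-term i j with root f (inj₁ i) ≟ᵥ root f (inj₂ j)
    ... | yes i∼j = begin
        M * N * (𝟙 (¬? (F ∋? i , j)) * τ (F ⊕ i , j))
      ≡⟨ cong (M * N *_) (𝟙-cong (¬? (F ∋? i , j)) (λ ij∉ → τ-⊕-inside f ij∉ i∼j)) ⟩
        M * N * (𝟙 (¬? (F ∋? i , j)) * 0ℚ)
      ≡⟨ solve 4 (λ M N d y → M :* N :* (d :* con 0ℚ) := con 0ℚ :* y) refl M N (𝟙 (¬? (F ∋? i , j))) (P * μ (root f (inj₁ i)) (root f (inj₂ j))) ⟩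
        0ℚ * (P * μ (root f (inj₁ i)) (root f (inj₂ j))) ∎
    ... | no i≁j with rest , π ← extract₂ (root∈ f (inj₁ i)) (root∈ f (inj₂ j)) i≁j = begin
        M * N * (𝟙 (¬? (F ∋? i , j)) * τ (F ⊕ i , j))
      ≡⟨ cong (λ d → M * N * (d * τ (F ⊕ i , j))) (𝟙-yes (¬? (F ∋? i , j)) (λ ij∈ → i≁j (closed f ij∈))) ⟩
        M * N * (1ℚ * τ (F ⊕ i , j))
      ≡⟨ cong (M * N *_) (ℚ.*-identityˡ _) ⟩
        M * N * τ (F ⊕ i , j)
      ≡⟨ forest-count c (join f i≁j π) (ℕ.suc-injective (trans (sym (↭-length π)) len)) ⟩
        componentValue (join f i≁j π)
      ≡⟨ value-join f i≁j π ⟩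
        P * μ (root f (inj₁ i)) (root f (inj₂ j))
      ≡⟨ sym (ℚ.*-identityˡ _) ⟩
        1ℚ * (P * μ (root f (inj₁ i)) (root f (inj₂ j))) ∎

-- Matchings

-- For a matching this turns the number of edges at a vertex into the indicator that the vertex is
-- matched.
∑-unique-witness : ∀ {k} {P : Fin k → Set} (P? : ∀ x → Dec (P x)) → (∀ {x y} → P x → P y → x ≡ y) →
  ∑ (allFin k) (λ x → 𝟙 (P? x)) ≡ 𝟙 (Fin.any? P?)
∑-unique-witness {k} P? unique with Fin.any? P?
... | yes (x , px) = trans
  (∑-cong (allFin k) (λ {y} _ → trans (𝟙-⇔ (P? y) (x Fin.≟ y) (unique px) (λ { refl → px })) (sym (ℚ.*-identityʳ _))))
  (∑-δ Fin._≟_ (λ _ → 1ℚ) (Unique.allFin⁺ k) (∈-allFin x))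
... | no ¬∃ = trans (∑-cong (allFin k) (λ {y} _ → 𝟙-no (P? y) (λ py → ¬∃ (y , py)))) (∑-0 (allFin k))

∑-allFin-suc : ∀ {k} (f : Fin (suc k) → ℚ) → ∑ (allFin (suc k)) f ≡ f Fin.zero + ∑ (allFin k) (f ∘ Fin.suc)
∑-allFin-suc {k} f = cong (_+_ (f Fin.zero))
  (trans (cong (λ xs → ∑ xs f) (sym (map-tabulate {n = k} id Fin.suc))) (∑-map Fin.suc (allFin k) f))

countTrue-∑ : ∀ {k} (r : Vec Bool k) → ℕ→ℚ (countTrue r) ≡ ∑ (allFin k) (λ j → 𝟙 (lookup r j Bool.≟ true))
countTrue-∑ []          = refl
countTrue-∑ (true ∷ r)  = trans (ℕ→ℚ-suc (countTrue r))
  (trans (cong (_+_ 1ℚ) (countTrue-∑ r)) (sym (∑-allFin-suc (λ j → 𝟙 (lookup (true ∷ r) j Bool.≟ true)))))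
countTrue-∑ (false ∷ r) = trans (countTrue-∑ r)
  (trans (sym (ℚ.+-identityˡ _)) (sym (∑-allFin-suc (λ j → 𝟙 (lookup (false ∷ r) j Bool.≟ true)))))

edgeCount-∑ : ∀ {m n} (E : EdgeSet m n) → ℕ→ℚ (edgeCount E) ≡ ∑ (allFin m) (λ i → ∑ (allFin n) (λ j → 𝟙 (E ∋? i , j)))
edgeCount-∑ []      = refl
edgeCount-∑ {n = n} (r ∷ E) = trans (ℕ→ℚ-+ (countTrue r) (edgeCount E))
  (trans (cong₂ _+_ (countTrue-∑ r) (edgeCount-∑ E)) (sym (∑-allFin-suc (λ i → ∑ (allFin n) (λ j → 𝟙 ((r ∷ E) ∋? i , j))))))

ℕ→ℚ-injective : ∀ a b → ℕ→ℚ a ≡ ℕ→ℚ b → a ≡ b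
ℕ→ℚ-injective zero    b       eq = sym (ℕ→ℚ≡0⇒≡0 b (sym eq))
ℕ→ℚ-injective (suc a) zero    eq = ⊥-elim (ℕ→ℚ-suc≢0 a eq)
ℕ→ℚ-injective (suc a) (suc b) eq = cong suc (ℕ→ℚ-injective a b (begin
    ℕ→ℚ a                ≡⟨ solve 1 (λ x → x := con 1ℚ :+ x :- con 1ℚ) refl (ℕ→ℚ a) ⟩
    1ℚ + ℕ→ℚ a - 1ℚ      ≡⟨ cong (_- 1ℚ) (trans (sym (ℕ→ℚ-suc a)) (trans eq (ℕ→ℚ-suc b))) ⟩
    1ℚ + ℕ→ℚ b - 1ℚ      ≡⟨ solve 1 (λ x → con 1ℚ :+ x :- con 1ℚ := x) refl (ℕ→ℚ b) ⟩
    ℕ→ℚ b                ∎))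
  where open ≡-Reasoning

length-filter-¬ : {A : Set} {P : A → Set} (P? : ∀ x → Dec (P x)) (xs : List A) →
  length (filter P? xs) ℕ.+ length (filter (¬? ∘ P?) xs) ≡ length xs
length-filter-¬ P? [] = refl
length-filter-¬ P? (x ∷ xs) with P? x
... | yes _ = cong suc (length-filter-¬ P? xs)
... | no _  = trans (ℕ.+-suc _ _) (cong suc (length-filter-¬ P? xs))

∏-two-valued : {A : Set} {P : A → Set} (P? : ∀ x → Dec (P x)) (xs : List A) (f : A → ℚ) (a b : ℕ) →
  (∀ x → P x → f x ≡ ℕ→ℚ a) → (∀ x → ¬ P x → f x ≡ ℕ→ℚ b) →
  ∏ xs f ≡ ℕ→ℚ (a ℕ.^ length (filter P? xs)) * ℕ→ℚ (b ℕ.^ length (filter (¬? ∘ P?) xs))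
∏-two-valued P? [] f a b fa fb = refl
∏-two-valued P? (x ∷ xs) f a b fa fb with P? x
... | yes px = trans (cong₂ _*_ (fa x px) (∏-two-valued P? xs f a b fa fb))
  (trans (sym (ℚ.*-assoc (ℕ→ℚ a) u v)) (cong (_* v) (sym (ℕ→ℚ-* a (a ℕ.^ length (filter P? xs))))))
  where
  u v : ℚ
  u = ℕ→ℚ (a ℕ.^ length (filter P? xs))
  v = ℕ→ℚ (b ℕ.^ length (filter (¬? ∘ P?) xs))
... | no ¬px = trans (cong₂ _*_ (fb x ¬px) (∏-two-valued P? xs f a b fa fb))
  (trans (swapˡ (ℕ→ℚ b) u v) (cong (u *_) (sym (ℕ→ℚ-* b (b ℕ.^ length (filter (¬? ∘ P?) xs))))))
  where
  u v : ℚ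
  u = ℕ→ℚ (a ℕ.^ length (filter P? xs))
  v = ℕ→ℚ (b ℕ.^ length (filter (¬? ∘ P?) xs))
  swapˡ : ∀ x y z → x * (y * z) ≡ y * (x * z)
  swapˡ = solve 3 (λ x y z → x :* (y :* z) := y :* (x :* z)) refl

∏-const : {A : Set} (xs : List A) (f : A → ℚ) (a : ℕ) → (∀ {x} → x ∈ xs → f x ≡ ℕ→ℚ a) → ∏ xs f ≡ ℕ→ℚ (a ℕ.^ length xs)
∏-const []       f a h = refl
∏-const (x ∷ xs) f a h = trans (cong₂ _*_ (h (here refl)) (∏-const xs f a (h ∘ there))) (sym (ℕ→ℚ-* a (a ℕ.^ length xs)))

module Matching {m n : ℕ} (E : EdgeSet m n) (matching : IsMatching E) where

  open Forest

  rowUnique : ∀ {i j k} → E ∋ₑ i , j → E ∋ₑ i , k → j ≡ k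
  rowUnique {i} {j} {k} = proj₁ matching i j k

  columnUnique : ∀ {i k j} → E ∋ₑ i , j → E ∋ₑ k , j → i ≡ k
  columnUnique {i} {k} {j} = proj₂ matching i k j

  leftMatched? : ∀ i → Dec (∃ λ j → E ∋ₑ i , j)
  leftMatched? i = Fin.any? λ j → E ∋? i , j

  rightMatched? : ∀ j → Dec (∃ λ i → E ∋ₑ i , j)
  rightMatched? j = Fin.any? λ i → E ∋? i , j

  freeRight : List (Fin n)
  freeRight = filter (¬? ∘ rightMatched?) (allFin n)

  -- A matched edge is represented by its left end, so the representatives are all left vertices and
  -- the unmatched right ones.
  rightRoot : Fin n → Vertex m n
  rightRoot j with rightMatched? j
  ... | yes (i , _) = inj₁ i
  ... | no _        = inj₂ j

  rightRoot-matched : ∀ {i j} → E ∋ₑ i , j → rightRoot j ≡ inj₁ i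
  rightRoot-matched {i} {j} ij∈ with rightMatched? j
  ... | yes (_ , kj∈) = cong inj₁ (columnUnique kj∈ ij∈)
  ... | no ¬∃         = ⊥-elim (¬∃ (i , ij∈))

  rightRoot-matched⁻ : ∀ {i j} → rightRoot j ≡ inj₁ i → E ∋ₑ i , j
  rightRoot-matched⁻ {i} {j} eq with rightMatched? j | eq
  ... | yes (_ , ij∈) | refl = ij∈
  ... | no _          | ()

  rightRoot-free : ∀ {j} → ¬ (∃ λ i → E ∋ₑ i , j) → rightRoot j ≡ inj₂ j
  rightRoot-free {j} ¬∃ with rightMatched? j
  ... | yes e = ⊥-elim (¬∃ e)
  ... | no _  = refl

  rightRoot-free⁻ : ∀ {j k} → rightRoot k ≡ inj₂ j → k ≡ j
  rightRoot-free⁻ {j} {k} eq with rightMatched? k | eq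
  ... | no _ | refl = refl

  free : ∀ {j} → j ∈ freeRight → ¬ (∃ λ i → E ∋ₑ i , j)
  free j∈ = proj₂ (∈-filter⁻ (¬? ∘ rightMatched?) {xs = allFin n} j∈)

  matchingForest : Forest E
  matchingForest .root (inj₁ i) = inj₁ i
  matchingForest .root (inj₂ j) = rightRoot j
  matchingForest .roots = map inj₁ (allFin m) ++ map inj₂ freeRight
  matchingForest .unique = Unique.++⁺ (Unique.map⁺ Sum.inj₁-injective (Unique.allFin⁺ m))
    (Unique.map⁺ Sum.inj₂-injective (Unique.filter⁺ (¬? ∘ rightMatched?) (Unique.allFin⁺ n))) λ (x , y) → disjoint x y
    where
    disjoint : ∀ {v} → v ∈ map inj₁ (allFin m) → v ∈ map inj₂ freeRight → ⊥
    disjoint x y with _ , _ , refl ← ∈-map⁻ inj₁ x with () ← proj₂ (proj₂ (∈-map⁻ inj₂ y))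
  matchingForest .root∈ (inj₁ i) = ∈-++⁺ˡ (∈-map⁺ inj₁ (∈-allFin i))
  matchingForest .root∈ (inj₂ j) with rightMatched? j
  ... | yes (i , _) = ∈-++⁺ˡ (∈-map⁺ inj₁ (∈-allFin i))
  ... | no ¬∃       = ∈-++⁺ʳ (map inj₁ (allFin m)) (∈-map⁺ inj₂ (∈-filter⁺ (¬? ∘ rightMatched?) (∈-allFin j) ¬∃))
  matchingForest .fixed l∈ with ∈-++⁻ (map inj₁ (allFin m)) l∈
  ... | inj₁ x with _ , _ , refl ← ∈-map⁻ inj₁ x = refl
  ... | inj₂ y with _ , j∈ , refl ← ∈-map⁻ inj₂ y = rightRoot-free (free j∈)
  matchingForest .joined (inj₁ i) = ε
  matchingForest .joined (inj₂ j) with rightMatched? j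
  ... | yes (i , ij∈) = _◅_ {j = inj₁ i} ij∈ ε
  ... | no _          = ε
  matchingForest .closed ij∈ = sym (rightRoot-matched ij∈)
  -- A detour would leave `i` along some remaining edge `i , k`; the matching condition makes this
  -- the deleted edge.
  matchingForest .bridges i j ij∈ (_◅_ {j = inj₂ k} ik∈ _) with refl ← rowUnique ij∈ (⊖-⊆ E i j i k ik∈) = ⊖-∌ E i j ik∈

  private
    f : Forest E
    f = matchingForest

    k m′ n′ : ℕ
    k = edgeCount E
    m′ = length (filter (¬? ∘ leftMatched?) (allFin m))
    n′ = length freeRight

  left-inj₁ : ∀ i → left f (inj₁ i) ≡ 1ℚ
  left-inj₁ i = trans
    (∑-cong (allFin m) (λ {x} _ → trans (𝟙-⇔ (inj₁ x ≟ᵥ inj₁ i) (i Fin.≟ x) (λ { refl → refl }) (λ { refl → refl }))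
      (sym (ℚ.*-identityʳ _))))
    (∑-δ Fin._≟_ (λ _ → 1ℚ) (Unique.allFin⁺ m) (∈-allFin i))

  left-inj₂ : ∀ j → left f (inj₂ j) ≡ 0ℚ
  left-inj₂ j = ∑-0 (allFin m)

  right-inj₁ : ∀ i → right f (inj₁ i) ≡ 𝟙 (leftMatched? i)
  right-inj₁ i = trans
    (∑-cong (allFin n) (λ {j} _ → 𝟙-⇔ (rightRoot j ≟ᵥ inj₁ i) (E ∋? i , j) rightRoot-matched⁻ rightRoot-matched))
    (∑-unique-witness (λ j → E ∋? i , j) rowUnique)

  right-inj₂ : ∀ {j} → j ∈ freeRight → right f (inj₂ j) ≡ 1ℚ
  right-inj₂ {j} j∈ = trans
    (∑-cong (allFin n) (λ {x} _ → trans (𝟙-⇔ (rightRoot x ≟ᵥ inj₂ j) (j Fin.≟ x)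
        (sym ∘ rightRoot-free⁻) (λ { refl → rightRoot-free (free j∈) }))
      (sym (ℚ.*-identityʳ _))))
    (∑-δ Fin._≟_ (λ _ → 1ℚ) (Unique.allFin⁺ n) (∈-allFin j))

  ∑-leftMatched : ∑ (allFin m) (λ i → 𝟙 (leftMatched? i)) ≡ ℕ→ℚ k
  ∑-leftMatched = sym (trans (edgeCount-∑ E) (∑-cong (allFin m) (λ {i} _ → ∑-unique-witness (λ j → E ∋? i , j) rowUnique)))

  length-leftMatched : length (filter leftMatched? (allFin m)) ≡ k
  length-leftMatched = ℕ→ℚ-injective _ _ (trans (length-filter leftMatched? (allFin m)) ∑-leftMatched)

  length-rightMatched : length (filter rightMatched? (allFin n)) ≡ k
  length-rightMatched = ℕ→ℚ-injective _ _ (begin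
      ℕ→ℚ (length (filter rightMatched? (allFin n)))
    ≡⟨ length-filter rightMatched? (allFin n) ⟩
      ∑ (allFin n) (λ j → 𝟙 (rightMatched? j))
    ≡⟨ ∑-cong (allFin n) (λ {j} _ → sym (∑-unique-witness (λ i → E ∋? i , j) columnUnique)) ⟩
      ∑ (allFin n) (λ j → ∑ (allFin m) λ i → 𝟙 (E ∋? i , j))
    ≡⟨ ∑-swap (allFin n) (allFin m) _ ⟩
      ∑ (allFin m) (λ i → ∑ (allFin n) λ j → 𝟙 (E ∋? i , j))
    ≡⟨ sym (edgeCount-∑ E) ⟩
      ℕ→ℚ k ∎)
    where open ≡-Reasoning

  -- Realises m - k as a natural number, the count of unmatched left vertices, so that the integer
  -- exponent m - k - 1 is a natural number minus one.
  m≡k+m′ : m ≡ k ℕ.+ m′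
  m≡k+m′ = sym (trans (cong (ℕ._+ m′) (sym length-leftMatched))
    (trans (length-filter-¬ leftMatched? (allFin m)) (length-tabulate {n = m} id)))

  n≡k+n′ : n ≡ k ℕ.+ n′
  n≡k+n′ = sym (trans (cong (ℕ._+ n′) (sym length-rightMatched))
    (trans (length-filter-¬ rightMatched? (allFin n)) (length-tabulate {n = n} id)))

  module _ {M N A : ℚ} (m≡M : ℕ→ℚ m ≡ M) (n≡N : ℕ→ℚ n ≡ N) (m+n≡A : ℕ→ℚ (m ℕ.+ n) ≡ A) where

    open ForestFormula {Vertex m n} M N
    open ≡-Reasoning

    private
      w = weight (left f) (right f)
      M+N≡A : M + N ≡ A
      M+N≡A = trans (cong₂ _+_ (sym m≡M) (sym n≡N)) (trans (sym (ℕ→ℚ-+ m n)) m+n≡A)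

    weight-matched : ∀ i → (∃ λ j → E ∋ₑ i , j) → w (inj₁ i) ≡ A
    weight-matched i e = trans (cong₂ (λ a b → a * N + b * M) (left-inj₁ i) (trans (right-inj₁ i) (𝟙-yes (leftMatched? i) e)))
      (trans (solve 2 (λ M N → con 1ℚ :* N :+ con 1ℚ :* M := M :+ N) refl M N) M+N≡A)

    weight-unmatched : ∀ i → ¬ (∃ λ j → E ∋ₑ i , j) → w (inj₁ i) ≡ N
    weight-unmatched i e = trans (cong₂ (λ a b → a * N + b * M) (left-inj₁ i) (trans (right-inj₁ i) (𝟙-no (leftMatched? i) e)))
      (solve 2 (λ M N → con 1ℚ :* N :+ con 0ℚ :* M := N) refl M N)

    weight-free : ∀ {j} → j ∈ freeRight → w (inj₂ j) ≡ M
    weight-free {j} j∈ = trans (cong₂ (λ a b → a * N + b * M) (left-inj₂ j) (right-inj₂ j∈))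
      (solve 2 (λ M N → con 0ℚ :* N :+ con 1ℚ :* M := M) refl M N)

    ∏-weight : ∏ (roots f) w ≡ ℕ→ℚ ((m ℕ.+ n) ℕ.^ k) * ℕ→ℚ (n ℕ.^ m′) * ℕ→ℚ (m ℕ.^ n′)
    ∏-weight = begin
        ∏ (roots f) w
      ≡⟨ ∏-++ (map inj₁ (allFin m)) _ w ⟩
        ∏ (map inj₁ (allFin m)) w * ∏ (map inj₂ freeRight) w
      ≡⟨ cong₂ _*_ (∏-map inj₁ (allFin m) w) (∏-map inj₂ freeRight w) ⟩
        ∏ (allFin m) (w ∘ inj₁) * ∏ freeRight (w ∘ inj₂)
      ≡⟨ cong₂ _*_ (∏-two-valued leftMatched? (allFin m) (w ∘ inj₁) (m ℕ.+ n) n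
             (λ i e → trans (weight-matched i e) (sym m+n≡A)) (λ i e → trans (weight-unmatched i e) (sym n≡N)))
           (∏-const freeRight (w ∘ inj₂) m (λ j∈ → trans (weight-free j∈) (sym m≡M))) ⟩
        ℕ→ℚ ((m ℕ.+ n) ℕ.^ length (filter leftMatched? (allFin m))) * ℕ→ℚ (n ℕ.^ m′) * ℕ→ℚ (m ℕ.^ n′)
      ≡⟨ cong (λ e → ℕ→ℚ ((m ℕ.+ n) ℕ.^ e) * ℕ→ℚ (n ℕ.^ m′) * ℕ→ℚ (m ℕ.^ n′)) length-leftMatched ⟩
        ℕ→ℚ ((m ℕ.+ n) ℕ.^ k) * ℕ→ℚ (n ℕ.^ m′) * ℕ→ℚ (m ℕ.^ n′) ∎

    -- Only a matched edge has vertices on both sides, one on each, and its weight is `A`.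
    ∑-share : ∑ (roots f) (share (left f) (right f)) ≡ ℕ→ℚ k * inv A
    ∑-share = begin
        ∑ (roots f) s
      ≡⟨ ∑-++ (map inj₁ (allFin m)) _ s ⟩
        ∑ (map inj₁ (allFin m)) s + ∑ (map inj₂ freeRight) s
      ≡⟨ cong₂ _+_ (∑-map inj₁ (allFin m) s) (∑-map inj₂ freeRight s) ⟩
        ∑ (allFin m) (s ∘ inj₁) + ∑ freeRight (s ∘ inj₂)
      ≡⟨ cong₂ _+_ (trans (∑-cong (allFin m) (λ {i} _ → share-left i)) (∑-*ʳ (allFin m) (inv A) _))
           (trans (∑-cong freeRight (λ {j} _ → share-free j)) (∑-0 freeRight)) ⟩
        ∑ (allFin m) (λ i → 𝟙 (leftMatched? i)) * inv A + 0ℚ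
      ≡⟨ trans (ℚ.+-identityʳ _) (cong (_* inv A) ∑-leftMatched) ⟩
        ℕ→ℚ k * inv A ∎
      where
      s : Vertex m n → ℚ
      s = share (left f) (right f)
      share-left : ∀ i → s (inj₁ i) ≡ 𝟙 (leftMatched? i) * inv A
      share-left i = trans (cong₂ (λ a b → a * b * inv (w (inj₁ i))) (left-inj₁ i) (right-inj₁ i))
        (trans (cong (_* inv (w (inj₁ i))) (ℚ.*-identityˡ (𝟙 (leftMatched? i)))) (𝟙-cong (leftMatched? i) (λ e → cong inv (weight-matched i e))))
      share-free : ∀ j → s (inj₂ j) ≡ 0ℚ
      share-free j = trans (cong (λ a → a * right f (inj₂ j) * inv (w (inj₂ j))) (left-inj₂ j))
        (solve 2 (λ x y → con 0ℚ :* x :* y := con 0ℚ) refl (right f (inj₂ j)) (inv (w (inj₂ j))))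

    matching-value : A ≢ 0ℚ → A * value (left f) (right f) (roots f) ≡
      ℕ→ℚ ((m ℕ.+ n) ℕ.^ k) * ℕ→ℚ (n ℕ.^ m′) * ℕ→ℚ (m ℕ.^ n′) * (A - ℕ→ℚ k)
    matching-value A≢0 = begin
        A * (∏ (roots f) w * (1ℚ - ∑ (roots f) (share (left f) (right f))))
      ≡⟨ cong₂ (λ P s → A * (P * (1ℚ - s))) ∏-weight ∑-share ⟩
        A * (P * (1ℚ - ℕ→ℚ k * inv A))
      ≡⟨ solve 4 (λ A P κ r → A :* (P :* (con 1ℚ :- κ :* r)) := P :* (A :- κ :* (A :* r))) refl A P (ℕ→ℚ k) (inv A) ⟩
        P * (A - ℕ→ℚ k * (A * inv A))
      ≡⟨ cong (λ e → P * (A - e)) (trans (cong (ℕ→ℚ k *_) (inv-* A≢0)) (ℚ.*-identityʳ _)) ⟩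
        P * (A - ℕ→ℚ k) ∎
      where
      P : ℚ
      P = ℕ→ℚ ((m ℕ.+ n) ℕ.^ k) * ℕ→ℚ (n ℕ.^ m′) * ℕ→ℚ (m ℕ.^ n′)

-- Integer powers

recip-* : ∀ d → ((+ 1) ℚ./ suc d) * ℕ→ℚ (suc d) ≡ 1ℚ
recip-* d = ℚ.toℚᵘ-injective (begin
    ℚ.toℚᵘ (((+ 1) ℚ./ suc d) * ℕ→ℚ (suc d))
  ≈⟨ ℚ.toℚᵘ-homo-* ((+ 1) ℚ./ suc d) (ℕ→ℚ (suc d)) ⟩
    ℚ.toℚᵘ ((+ 1) ℚ./ suc d) ℚᵘ.* ℚ.toℚᵘ (ℕ→ℚ (suc d))
  ≈⟨ ℚᵘ.*-cong (ℚ.toℚᵘ-fromℚᵘ (ℚᵘ.mkℚᵘ (+ 1) d)) (ℚ.toℚᵘ-fromℚᵘ (ℚᵘ.mkℚᵘ (+ suc d) 0)) ⟩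
    ℚᵘ.mkℚᵘ (+ 1) d ℚᵘ.* ℚᵘ.mkℚᵘ (+ suc d) 0
  ≈⟨ ℚᵘ.*≡* (cong +_ (trans (cong (ℕ._* 1) (ℕ.*-identityˡ (suc d))) (sym (ℕ.*-identityˡ _)))) ⟩
    ℚᵘ.1ℚᵘ ∎)
  where open ℚᵘ.≃-Reasoning

-- Each exponent of the formula is a natural number minus one, so a negative power can only be the
-- reciprocal, and one factor `b` clears it.
zpow-pred : ∀ b e → 1 ℕ.≤ b → zpow b (+ e -ℤ + 1) * ℕ→ℚ b ≡ ℕ→ℚ (b ℕ.^ e)
zpow-pred (suc b) zero    _ = trans
  -- The denominator `suc b ^ 1` computes to `suc (b * 1)`, so the factor `suc b` is rewritten to
  -- the same form.
  (cong (λ c → zpow (suc b) -[1+ 0 ] * ℕ→ℚ (suc c)) (sym (ℕ.*-identityʳ b))) (recip-* (b ℕ.* 1))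
zpow-pred (suc b) (suc e) _ = trans (ℚ.*-comm (ℕ→ℚ (suc b ℕ.^ e)) (ℕ→ℚ (suc b))) (sym (ℕ→ℚ-* (suc b) (suc b ℕ.^ e)))

pos-difference : ∀ {s} k r → s ≡ k ℕ.+ r → + s -ℤ + k ≡ + r
pos-difference k r refl = trans (ℤ.m-n≡m⊖n (k ℕ.+ r) k)
  (trans (ℤ.⊖-≥ (ℕ.m≤m+n k r)) (cong +_ (ℕ.m+n∸m≡n k r)))

ℕ→ℚ-difference : ∀ {s} k r → s ≡ k ℕ.+ r → (+ s -ℤ + k) ℚ./ 1 ≡ ℕ→ℚ s - ℕ→ℚ k
ℕ→ℚ-difference {s} k r eq = begin
    (+ s -ℤ + k) ℚ./ 1           ≡⟨ cong (ℚ._/ 1) (pos-difference k r eq) ⟩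
    ℕ→ℚ r                        ≡⟨ cancel (ℕ→ℚ k) (ℕ→ℚ r) ⟩
    (ℕ→ℚ k + ℕ→ℚ r) - ℕ→ℚ k      ≡⟨ cong (_- ℕ→ℚ k) (sym (trans (cong ℕ→ℚ eq) (ℕ→ℚ-+ k r))) ⟩
    ℕ→ℚ s - ℕ→ℚ k                ∎
  where
  open ≡-Reasoning
  cancel : ∀ x y → y ≡ (x + y) - x
  cancel = solve 2 (λ x y → y := (x :+ y) :- x) refl

-- Multiplying by `A`, `M` and `N` turns the three integer powers into natural ones. The same
-- factors free the forest formula of `M * N` and the value of a matching of `inv A`, so the
-- comparison involves no division.
clear-denominators : ∀ {A M N κ a b c B t V} x y z → A ≢ 0ℚ → M ≢ 0ℚ → N ≢ 0ℚ →
  x * A ≡ a → y * M ≡ b → z * N ≡ c → B ≡ A - κ →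
  M * N * t ≡ V → A * V ≡ a * c * b * (A - κ) → t ≡ x * B * y * z
clear-denominators {A} {M} {N} {B = B} {t} x y z A≢0 M≢0 N≢0 refl refl refl refl refl eq =
  *-cancelˡ _ _ N≢0 (*-cancelˡ _ _ M≢0 (*-cancelˡ _ _ A≢0 (begin
    A * (M * (N * t))
  ≡⟨ cong (A *_) (sym (ℚ.*-assoc M N t)) ⟩
    A * (M * N * t)
  ≡⟨ eq ⟩
    x * A * (z * N) * (y * M) * B
  ≡⟨ solve 7 (λ A M N x y z B → x :* A :* (z :* N) :* (y :* M) :* B := A :* (M :* (N :* (x :* B :* y :* z))))
       refl A M N x y z B ⟩
    A * (M * (N * (x * B * y * z))) ∎)))
  where open ≡-Reasoning

ℕ→ℚ-≥1 : ∀ {b} → 1 ℕ.≤ b → ℕ→ℚ b ≢ 0ℚ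
ℕ→ℚ-≥1 {suc b} _ = ℕ→ℚ-suc≢0 b

theorem1p3 : (m n : ℕ) → 1 ℕ.≤ m → 1 ℕ.≤ n → (k : ℕ) → (M : EdgeSet m n) →
    IsMatching M → edgeCount M ≡ k →
    Σ ℕ λ τ → CountIs (λ T → IsSpanningTree T × (M ⊆ₑ T)) τ ×
    (ℕ→ℚ τ ≡
    zpow (m ℕ.+ n) ((+ k) -ℤ (+ 1))
    * (((+ (m ℕ.+ n)) -ℤ (+ k)) ℚ./ 1)
    * zpow m (((+ n) -ℤ (+ k)) -ℤ (+ 1))
    * zpow n (((+ m) -ℤ (+ k)) -ℤ (+ 1)))
-- Splitting `m` provides the left vertex `inj₁ Fin.zero`, which `ForestCount` takes as evidence
-- that there is a vertex.
theorem1p3 m@(suc _) n 1≤m 1≤n _ M matching refl =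
  length (filter (extends? M) allEdgeSets) , count-filter (extends? M) ,
  clear-denominators (zpow (m ℕ.+ n) (+ k -ℤ + 1)) (zpow m (+ n -ℤ + k -ℤ + 1)) (zpow n (+ m -ℤ + k -ℤ + 1))
    A≢0 (ℕ→ℚ-≥1 1≤m) (ℕ→ℚ-≥1 1≤n)
    (zpow-pred (m ℕ.+ n) k 1≤m+n)
    (trans (cong (λ e → zpow m (e -ℤ + 1) * ℕ→ℚ m) (pos-difference k n′ n≡k+n′)) (zpow-pred m n′ 1≤m))
    (trans (cong (λ e → zpow n (e -ℤ + 1) * ℕ→ℚ n) (pos-difference k m′ m≡k+m′)) (zpow-pred n m′ 1≤n))
    -- The difference m + n - k is the natural number of components of the matching other than the
    -- right-hand matched ends: `m′` unmatched left vertices plus all `n` right vertices.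
    (ℕ→ℚ-difference k (m′ ℕ.+ n) (trans (cong (ℕ._+ n) m≡k+m′) (ℕ.+-assoc k m′ n)))
    (trans (cong (ℕ→ℚ m * ℕ→ℚ n *_) (length-filter (extends? M) allEdgeSets))
      (forest-count _ matchingForest refl))
    (matching-value refl refl refl A≢0)
  where
  k = edgeCount M
  1≤m+n : 1 ℕ.≤ m ℕ.+ n
  1≤m+n = ℕ.≤-trans 1≤m (ℕ.m≤m+n m n)
  A≢0 : ℕ→ℚ (m ℕ.+ n) ≢ 0ℚ
  A≢0 = ℕ→ℚ-≥1 1≤m+n
  open Matching M matching
  open ForestCount {m} {n} (inj₁ Fin.zero) {ℕ→ℚ m} {ℕ→ℚ n} refl refl (ℕ→ℚ-≥1 1≤m) (ℕ→ℚ-≥1 1≤n)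
  m′ n′ : ℕ
  m′ = length (filter (¬? ∘ leftMatched?) (allFin m))
  n′ = length freeRight
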